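{- For every nonnegative integer $n$, $$\sum_{j=0}^{\infty}p(n-2T_j)=\sum_{j=0}^{\infty}pod(j)\,\overline{\mathcal{E}\mathcal{O}}(n-j).$$
   Context: $p(n)$ denotes the number of (unrestricted) partitions of $n$, and $pod(n)$ the number of partitions of $n$ in which odd parts are distinct and even parts may be repeated; $p(0)=pod(0)=1$. For $j\ge0$, $T_j=\frac{j(j+1)}{2}$. $\mathcal{E}\mathcal{O}(n)$ counts the partitions of $n$ in which every even part is less than each odd part, and $\overline{\mathcal{E}\mathcal{O}}(n)$ is the number of partitions counted by $\mathcal{E}\mathcal{O}(n)$ in which only the largest even part appears an odd number of times (partitions with no even parts in which every part appears an even number of times are also counted). For example $\overline{\mathcal{E}\mathcal{O}}(8)=5$, the relevant partitions being $8$, $4+2+2$, $3+3+2$, $3+3+1+1$, $1+1+1+1+1+1+1+1$. Its generating function is $$\sum_{n\ge0}\overline{\mathcal{E}\mathcal{O}}(n)q^n=\prod_{k\ge1}\frac{(1-q^{4k})^3}{(1-q^{2k})^2}.$$ The functions $p$ and $\overline{\mathcal{E}\mathcal{O}}$ are $0$ at negative arguments. -}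

module Defs where

open import Data.Integer using (ℤ; +_; -[1+_])
open import Data.List using (List; []; _∷_; _++_; map; concatMap; filter; length; replicate; upTo)
open import Data.List.Membership.Propositional using (_∈_)
open import Data.List.Membership.Propositional.Properties
  using (∈-concat⁺′; ∈-concat⁻′; ∈-map⁺; ∈-map⁻; ∈-upTo⁺; ∈-upTo⁻)
open import Data.List.Properties using (++-cancelˡ; ∷-injectiveʳ)
open import Data.List.Relation.Binary.Disjoint.Propositional using (Disjoint)
open import Data.List.Relation.Unary.All as All using (All; []; _∷_; all?)
open import Data.List.Relation.Unary.All.Properties as All using ()
open import Data.List.Relation.Unary.AllPairs as AllPairs using (AllPairs; []; _∷_)
open import Data.List.Relation.Unary.AllPairs.Properties as AllPairs using ()
open import Data.List.Relation.Unary.Any using (here)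
open import Data.List.Relation.Unary.Linked using (Linked)
open import Data.List.Relation.Unary.Linked.Properties using (AllPairs⇒Linked; Linked⇒AllPairs)
open import Data.List.Relation.Unary.Unique.Propositional using (Unique)
import Data.List.Relation.Unary.Unique.DecPropositional as DecUnique
import Data.List.Relation.Unary.Unique.Propositional.Properties as Unique
open import Data.Nat
open import Data.Nat.Divisibility using (_∣_; _∣?_)
open import Data.Nat.DivMod using (m/n*n≤m; m*n/n≡m; /-monoˡ-≤)
open import Data.Nat.ListAction using (sum)
open import Data.Nat.ListAction.Properties using (sum-++)
open import Data.Nat.Properties
open import Data.Product using (∃; _×_; _,_; proj₁; proj₂)
open import Function using (_∘_; flip)
open import Relation.Binary.PropositionalEquality
open import Relation.Nullary using (¬_; ¬?; yes; no; _×-dec_; _→-dec_; contradiction)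
open import Relation.Unary using (Decidable)

Even Odd : ℕ → Set
Even a = 2 ∣ a
Odd a = ¬ Even a

even? : Decidable Even
even? = 2 ∣?_

odd? : Decidable Odd
odd? a = ¬? (even? a)

record IsPartition (n : ℕ) (xs : List ℕ) : Set where
  constructor isPartition
  field
    decreasing : Linked _≥_ xs
    positive   : All (1 ≤_) xs
    total      : sum xs ≡ n

-- All partitions of n with parts ≤ k; m is the multiplicity of the part suc k.
partitions≤ : ℕ → ℕ → List (List ℕ)
partitions≤ zero    zero    = [] ∷ []
partitions≤ zero    (suc n) = []
partitions≤ (suc k) n =
  concatMap (λ m → map (replicate m (suc k) ++_) (partitions≤ k (n ∸ m * suc k)))
            (upTo (suc (n / suc k)))

-- That this list contains every partition of n exactly once is proved at the
-- end of this module (partitions-sound, partitions-complete, partitions-unique).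
partitions : ℕ → List (List ℕ)
partitions n = partitions≤ n n

count : {P : List ℕ → Set} → Decidable P → ℕ → ℕ
count P? n = length (filter P? (partitions n))

multiplicity : ℕ → List ℕ → ℕ
multiplicity a xs = length (filter (_≟ a) xs)

OddPartsDistinct : List ℕ → Set
OddPartsDistinct xs = Unique (filter odd? xs)

oddPartsDistinct? : Decidable OddPartsDistinct
oddPartsDistinct? xs = DecUnique.unique? _≟_ (filter odd? xs)

EvensBelowOdds : List ℕ → Set
EvensBelowOdds xs = All (λ a → All (λ b → Even a → Odd b → a < b) xs) xs

evensBelowOdds? : Decidable EvensBelowOdds
evensBelowOdds? xs =
  all? (λ a → all? (λ b → even? a →-dec (odd? b →-dec (a <? b))) xs) xs

LargestEven : List ℕ → ℕ → Set
LargestEven xs a = Even a × All (λ b → Even b → b ≤ a) xs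

largestEven? : ∀ xs → Decidable (LargestEven xs)
largestEven? xs a = even? a ×-dec all? (λ b → even? b →-dec (b ≤? a)) xs

-- A part has odd multiplicity exactly when it is the largest even part; if
-- there is no even part, this says that every multiplicity is even.
OnlyLargestEvenOddly : List ℕ → Set
OnlyLargestEvenOddly xs =
  All (λ a → (Odd (multiplicity a xs) → LargestEven xs a)
           × (LargestEven xs a → Odd (multiplicity a xs))) xs

onlyLargestEvenOddly? : Decidable OnlyLargestEvenOddly
onlyLargestEvenOddly? xs =
  all? (λ a → (odd? (multiplicity a xs) →-dec largestEven? xs a)
        ×-dec (largestEven? xs a →-dec odd? (multiplicity a xs))) xs

EOBarPartition : List ℕ → Set
EOBarPartition xs = EvensBelowOdds xs × OnlyLargestEvenOddly xs

eoBarPartition? : Decidable EOBarPartition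
eoBarPartition? xs = evensBelowOdds? xs ×-dec onlyLargestEvenOddly? xs

p : ℤ → ℕ
p (+ n)    = length (partitions n)
p -[1+ _ ] = 0

pod : ℕ → ℕ
pod = count oddPartsDistinct?

EOBar : ℤ → ℕ
EOBar (+ n)    = count eoBarPartition? n
EOBar -[1+ _ ] = 0

T : ℕ → ℕ
T j = j * (j + 1) / 2

-- The infinite series of the f j converges (its partial sums are eventually
-- constant) with value s.
HasSum : (ℕ → ℕ) → ℕ → Set
HasSum f s = ∃ λ N → ∀ M → N ≤ M → sum (map f (upTo M)) ≡ s

_ : map (EOBar ∘ +_) (upTo 9) ≡ 1 ∷ 0 ∷ 2 ∷ 0 ∷ 2 ∷ 0 ∷ 4 ∷ 0 ∷ 5 ∷ []
_ = refl

private
  sum-replicate : ∀ m a → sum (replicate m a) ≡ m * a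
  sum-replicate zero    a = refl
  sum-replicate (suc m) a = cong (λ s → a + s) (sum-replicate m a)

  record Bounded (k n : ℕ) (xs : List ℕ) : Set where
    constructor bounded
    field
      decreasing : AllPairs _≥_ xs
      range      : All (λ a → 1 ≤ a × a ≤ k) xs
      total      : sum xs ≡ n

  block : ℕ → ℕ → ℕ → List (List ℕ)
  block k n m = map (replicate m (suc k) ++_) (partitions≤ k (n ∸ m * suc k))

  sound : ∀ k n {xs} → xs ∈ partitions≤ k n → Bounded k n xs
  sound zero    zero (here refl) = bounded [] [] refl
  sound (suc k) n xs∈
    with _ , xs∈b , b∈ ← ∈-concat⁻′ (map (block k n) (upTo (suc (n / suc k)))) xs∈
    with m , m∈ , refl ← ∈-map⁻ (block k n) {xs = upTo (suc (n / suc k))} b∈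
    with ys , ys∈ , refl ← ∈-map⁻ (replicate m (suc k) ++_) xs∈b
    with bounded dec rng tot ← sound k (n ∸ m * suc k) ys∈
    = bounded
        (AllPairs.++⁺ (decreasing-replicate m) dec
          (All.replicate⁺ m (All.map (m≤n⇒m≤1+n ∘ proj₂) rng)))
        (All.++⁺ (All.replicate⁺ m (s≤s z≤n , ≤-refl))
                 (All.map (λ (l , u) → l , m≤n⇒m≤1+n u) rng))
        (trans (sum-++ (replicate m (suc k)) ys)
          (trans (cong₂ _+_ (sum-replicate m (suc k)) tot)
                 (m+[n∸m]≡n m*k≤n)))
    where
    m*k≤n : m * suc k ≤ n
    m*k≤n = ≤-trans (*-monoˡ-≤ (suc k) (s≤s⁻¹ (∈-upTo⁻ {suc (n / suc k)} m∈))) (m/n*n≤m n (suc k))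
    decreasing-replicate : ∀ m → AllPairs _≥_ (replicate m (suc k))
    decreasing-replicate zero    = []
    decreasing-replicate (suc m) = All.replicate⁺ m ≤-refl ∷ decreasing-replicate m

  split : ∀ k xs → AllPairs _≥_ xs → All (λ a → 1 ≤ a × a ≤ suc k) xs →
          ∃ λ m → ∃ λ ys → xs ≡ replicate m (suc k) ++ ys ×
          AllPairs _≥_ ys × All (λ a → 1 ≤ a × a ≤ k) ys
  split k [] dec rng = 0 , [] , refl , [] , []
  split k (x ∷ xs) (x≥ ∷ dec) ((1≤x , x≤) ∷ rng) with x ≟ suc k
  ... | yes refl with m , ys , refl , dec′ , rng′ ← split k xs dec rng
      = suc m , ys , refl , dec′ , rng′
  ... | no x≢ = 0 , x ∷ xs , refl , x≥ ∷ dec ,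
        (1≤x , x≤k) ∷ All.zipWith (λ ((l , _) , u) → l , ≤-trans u x≤k) (rng , x≥)
    where
    x≤k : x ≤ k
    x≤k = s≤s⁻¹ (≤∧≢⇒< x≤ x≢)

  complete : ∀ k n {xs} → Bounded k n xs → xs ∈ partitions≤ k n
  complete zero n (bounded [] [] refl) = here refl
  complete zero n (bounded _ ((1≤a , a≤0) ∷ _) _) = contradiction (≤-trans 1≤a a≤0) λ ()
  complete (suc k) n {xs} (bounded dec rng tot)
    with m , ys , refl , dec′ , rng′ ← split k xs dec rng
    = ∈-concat⁺′
        (∈-map⁺ (replicate m (suc k) ++_) (complete k (n ∸ m * suc k)
          (bounded dec′ rng′ (trans (sym (m+n∸m≡n (m * suc k) (sum ys))) (cong (_∸ m * suc k) total′)))))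
        (∈-map⁺ (block k n) (∈-upTo⁺ (s≤s m≤)))
    where
    total′ : m * suc k + sum ys ≡ n
    total′ = trans (cong (λ s → s + sum ys) (sym (sum-replicate m (suc k))))
                   (trans (sym (sum-++ (replicate m (suc k)) ys)) tot)
    m≤ : m ≤ n / suc k
    m≤ = subst (_≤ n / suc k) (m*n/n≡m m (suc k))
           (/-monoˡ-≤ (suc k) (subst (m * suc k ≤_) total′ (m≤m+n (m * suc k) (sum ys))))

  replicate-injective : ∀ k m m′ {ys ys′} → All (_≤ k) ys → All (_≤ k) ys′ →
    replicate m (suc k) ++ ys ≡ replicate m′ (suc k) ++ ys′ → m ≡ m′
  replicate-injective k zero    zero     _ _ _ = refl
  replicate-injective k zero    (suc _)  (k<k ∷ _) _ refl = contradiction k<k 1+n≰n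
  replicate-injective k (suc _) zero     _ (k<k ∷ _) refl = contradiction k<k 1+n≰n
  replicate-injective k (suc m) (suc m′) u u′ eq =
    cong suc (replicate-injective k m m′ u u′ (∷-injectiveʳ eq))

  unique : ∀ k n → Unique (partitions≤ k n)
  unique zero    zero    = [] ∷ []
  unique zero    (suc n) = []
  unique (suc k) n = Unique.concat⁺
    (All.map⁺ (All.universal (λ m → Unique.map⁺ (++-cancelˡ (replicate m (suc k)) _ _)
                                      (unique k (n ∸ m * suc k))) _))
    (AllPairs.map⁺ (AllPairs.map disjoint (Unique.upTo⁺ (suc (n / suc k)))))
    where
    disjoint : ∀ {m m′} → m ≢ m′ → Disjoint (block k n m) (block k n m′)
    disjoint {m} {m′} m≢m′ (∈b , ∈b′)
      with ys , ys∈ , refl ← ∈-map⁻ (replicate m (suc k) ++_) ∈b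
      with ys′ , ys′∈ , eq ← ∈-map⁻ (replicate m′ (suc k) ++_) ∈b′
      = m≢m′ (replicate-injective k m m′
          (All.map proj₂ (Bounded.range (sound k _ ys∈)))
          (All.map proj₂ (Bounded.range (sound k _ ys′∈))) eq)

  parts≤sum : ∀ xs → All (_≤ sum xs) xs
  parts≤sum []       = []
  parts≤sum (x ∷ xs) =
    m≤m+n x (sum xs) ∷ All.map (λ a≤ → ≤-trans a≤ (m≤n+m (sum xs) x)) (parts≤sum xs)

partitions-sound : ∀ {n xs} → xs ∈ partitions n → IsPartition n xs
partitions-sound {n} xs∈ with bounded dec rng tot ← sound n n xs∈ =
  isPartition (AllPairs⇒Linked dec) (All.map proj₁ rng) tot

partitions-complete : ∀ {n xs} → IsPartition n xs → xs ∈ partitions n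
partitions-complete {n} {xs} (isPartition dec pos refl) = complete n n
  (bounded (Linked⇒AllPairs (flip ≤-trans) dec) (All.zip (pos , parts≤sum xs)) refl)

partitions-unique : ∀ n → Unique (partitions n)
partitions-unique n = unique n n

{-# OPTIONS --safe #-}

-- Write x = q² and ψ = Σ x^(T j). In terms of generating functions
--   pod = Π (1 + q^(2i-1)) / (1 - q^(2i)),   EO̅ = Σ_k x^k / Π_{i≤k} (1 - x^(2i)) Π_{i>k} (1 - x^(2i-1)),
-- where k is half the largest even part. With D = Π 1 / (1 - x^(2i-1)), pairing equal odd parts gives
-- pod · D = P, the generating function of p, while EO̅ = D · Σ_k A_k with
-- A_k = x^k (x; x²)_k / (x²; x²)_k. A case of the Rogers–Fine identity says Σ_k A_k = ψ, so that
-- pod · EO̅ = P · ψ. All products and sums are truncated, and coefficients compared below the truncation.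
module Submission where

open import Defs
open import Algebra.Bundles using (CommutativeRing)
open import Algebra.Structures using (IsCommutativeRing)
open import Data.List using (List; []; _∷_; _++_; length; filter; map; replicate; concatMap; applyUpTo; upTo)
open import Data.List.Membership.Propositional using (_∈_)
open import Data.List.Membership.Propositional.Properties using (∈-++⁺ʳ)
open import Data.List.Properties
  using (length-++; length-map; filter-++; filter-all; filter-none; filter-accept; filter-reject; map-upTo)
open import Data.List.Relation.Unary.All as All using (All; []; _∷_; all?)
open import Data.List.Relation.Unary.AllPairs using ([]; _∷_)
open import Data.List.Relation.Unary.Unique.Propositional using (Unique)
open import Data.Nat as ℕ using (ℕ; zero; suc; NonZero; z≤n; s≤s)
open import Data.Nat.Divisibility
  using (divides; ∣m+n∣m⇒∣n; ∣m∣n⇒∣m+n; ∣m⇒∣m*n; ∣n⇒∣m*n; ∣-refl; ∣1⇒≡1; _∣0)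
open import Data.Nat.ListAction using (sum)
open import Data.Nat.Tactic.RingSolver using () renaming (solve-∀ to ℕ-solve-∀)
open import Data.Integer.Tactic.RingSolver using () renaming (solve-∀ to ℤ-solve-∀)
open import Data.Product using (∃; _×_; _,_; proj₁; proj₂)
open import Data.Unit using (tt)
open import Function using (_∘_; const; case_of_)
open import Level using (0ℓ)
open import Relation.Binary.PropositionalEquality as ≡ using (_≡_; _≢_; module ≡-Reasoning)
open import Relation.Nullary using (¬_; yes; no; contradiction; _×-dec_)
open import Relation.Nullary.Decidable using (decidable-stable)
open import Relation.Unary using (Decidable)
open import Relation.Unary.Properties using (U?)
import Algebra.Properties.CommutativeSemigroup as CommutativeSemigroupProperties
import Algebra.Properties.Ring as RingProperties
import Algebra.Properties.Semiring.Exp as Exp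
import Algebra.Solver.Ring.NaturalCoefficients.Default as Solver
import Data.Integer.Properties as ℤ
import Data.List.Relation.Unary.All.Properties as All
import Data.Nat.DivMod as ℕ
import Data.Nat.Properties as ℕ
import Relation.Binary.Reasoning.Setoid as SetoidReasoning

-- The Rogers–Fine recursion

-- One use of the Rogers-Fine recursion changes its parameter, so the sum is treated as a family in
-- y = x^(2m+1). With S(y) = Σ_k y^k (y; x²)_k / (yx; x²)_k the recursion reads S(y) = 1 + y + y²x
-- S(yx²). Multiplied by x^(T(2m)), its right side becomes x^(T(2m)) + x^(T(2m+1)) + x^(T(2m+2))
-- S(yx²): two terms of ψ and the next member of the family. Cutting the sum off at K leaves a
-- remainder y B_K of order at least 2(K+1) in q, which is invisible below the truncation. On the
-- partition side the truncation is a bound on the parts. Raising the bound by one gives a recursion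
-- in which 1/(1 - q^a) enters only as the solution `inv a` of c = 1 + q^a c. The algebra therefore
-- needs no convergence and takes place in an arbitrary commutative ring; power series come in only
-- when orders are compared.

module RogersFine (R : CommutativeRing 0ℓ 0ℓ) where

  open CommutativeRing R
  open RingProperties ring using (+-cancelʳ)
  open Exp semiring using (_^_; ^-homo-*)
  open Solver commutativeSemiring using (solve; _:+_; _:*_; _:=_; con)
  open SetoidReasoning setoid

  module Identities (q : Carrier)
    (inv : (a : ℕ) .{{_ : NonZero a}} → Carrier)
    (inv-unfold : (a : ℕ) .{{_ : NonZero a}} → inv a ≈ 1# + q ^ a * inv a)
    where

    complement : ∀ x → (1# - x) + x ≈ 1#
    complement x = begin
      (1# - x) + x     ≈⟨ +-assoc 1# (- x) x ⟩
      1# + (- x + x)   ≈⟨ +-congˡ (-‿inverseˡ x) ⟩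
      1# + 0#          ≈⟨ +-identityʳ 1# ⟩
      1#               ∎

    inv-inverse : ∀ a .{{_ : NonZero a}} → inv a * (1# - q ^ a) ≈ 1#
    inv-inverse a = +-cancelʳ (q ^ a * inv a) _ _ (begin
      inv a * (1# - q ^ a) + q ^ a * inv a
        ≈⟨ solve 3 (λ i y x → i :* y :+ x :* i := i :* (y :+ x)) refl (inv a) (1# - q ^ a) (q ^ a) ⟩
      inv a * ((1# - q ^ a) + q ^ a)
        ≈⟨ *-congˡ (complement (q ^ a)) ⟩
      inv a * 1#
        ≈⟨ *-identityʳ (inv a) ⟩
      inv a
        ≈⟨ inv-unfold a ⟩
      1# + q ^ a * inv a ∎)

    -- Since `inv a` inverts `1# - q ^ a`, the equation has exactly one solution. The geometric sums
    -- over multiplicities are evaluated through this uniqueness.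
    inv-unique : ∀ a .{{_ : NonZero a}} {c f} → c ≈ f + q ^ a * c → c ≈ inv a * f
    inv-unique a {c} {f} c≈ = begin
      c                              ≈⟨ *-identityˡ c ⟨
      1# * c                         ≈⟨ *-congʳ (inv-inverse a) ⟨
      inv a * (1# - q ^ a) * c       ≈⟨ *-assoc _ _ _ ⟩
      inv a * ((1# - q ^ a) * c)     ≈⟨ *-congˡ y*c≈f ⟩
      inv a * f                      ∎
      where
      y*c≈f : (1# - q ^ a) * c ≈ f
      y*c≈f = +-cancelʳ (q ^ a * c) _ _ (begin
        (1# - q ^ a) * c + q ^ a * c  ≈⟨ distribʳ c (1# - q ^ a) (q ^ a) ⟨
        ((1# - q ^ a) + q ^ a) * c    ≈⟨ *-congʳ (complement (q ^ a)) ⟩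
        1# * c                        ≈⟨ *-identityˡ c ⟩
        c                             ≈⟨ c≈ ⟩
        f + q ^ a * c                 ∎)

    -- This is (1 + x) / (1 - x²) = 1 / (1 - x) for x = q^a: at most one copy of a part, together
    -- with pairs of copies, amounts to an arbitrary multiplicity.
    inv-double : ∀ a .{{_ : NonZero a}} .{{_ : NonZero (a ℕ.* 2)}} →
                 inv (a ℕ.* 2) + q ^ a * inv (a ℕ.* 2) ≈ inv a
    inv-double a = trans (inv-unique a (begin
      u + x * u                     ≈⟨ +-congʳ (inv-unfold (a ℕ.* 2)) ⟩
      (1# + q ^ (a ℕ.* 2) * u) + x * u ≈⟨ +-congʳ (+-congˡ (*-congʳ x²)) ⟩
      (1# + (x * x) * u) + x * u
        ≈⟨ solve 3 (λ o x u → (o :+ (x :* x) :* u) :+ x :* u := o :+ x :* (u :+ x :* u)) refl 1# x u ⟩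
      1# + x * (u + x * u)          ∎)) (*-identityʳ (inv a))
      where
      x u : Carrier
      x = q ^ a
      u = inv (a ℕ.* 2)
      x² : q ^ (a ℕ.* 2) ≈ x * x
      x² = trans (reflexive (≡.cong (q ^_) (≡.trans (ℕ.*-comm a 2) (≡.cong (a ℕ.+_) (ℕ.+-identityʳ a)))))
                 (^-homo-* q a a)

    -- With x = q², these are z k = x^(2k+1), w k = x^(2k+2) and t k = x^(2k).
    z w t Z W u v : ℕ → Carrier
    z k = q ^ (suc (k ℕ.* 2) ℕ.* 2)
    w k = q ^ (suc k ℕ.* 2 ℕ.* 2)
    t k = q ^ (k ℕ.* 4)
    Z k = 1# - z k
    W k = 1# - w k
    u k = inv (suc (k ℕ.* 2) ℕ.* 2)
    v k = inv (suc k ℕ.* 2 ℕ.* 2)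

    -- A m k = y^k (y; x²)_k / (yx; x²)_k and B m k = y^k (yx²; x²)_k / (yx; x²)_k,
    -- where y = z m.
    A B : ℕ → ℕ → Carrier
    A m zero    = 1#
    A m (suc k) = A m k * (z m * Z (k ℕ.+ m) * v (k ℕ.+ m))
    B m zero    = 1#
    B m (suc k) = B m k * (z m * Z (suc k ℕ.+ m) * v (k ℕ.+ m))

    ^-shuffle : ∀ a b c d → a ℕ.+ b ≡ c ℕ.+ d → q ^ a * q ^ b ≈ q ^ c * q ^ d
    ^-shuffle a b c d eq =
      trans (sym (^-homo-* q a b)) (trans (reflexive (≡.cong (q ^_) eq)) (^-homo-* q c d))

    -- Both sides have the numerator (y; x²)_(k+1): on the left its last factor is appended, on the
    -- right its first.
    A-B : ∀ m k → A m k * Z (k ℕ.+ m) ≈ Z m * B m k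
    A-B m zero    = *-comm 1# (Z m)
    A-B m (suc k) = begin
      A m k * (z m * Z (k ℕ.+ m) * v (k ℕ.+ m)) * Z (suc k ℕ.+ m)
        ≈⟨ solve 5 (λ a z y v y′ → a :* (z :* y :* v) :* y′ := (a :* y) :* (z :* y′ :* v))
             refl (A m k) (z m) (Z (k ℕ.+ m)) (v (k ℕ.+ m)) (Z (suc k ℕ.+ m)) ⟩
      (A m k * Z (k ℕ.+ m)) * (z m * Z (suc k ℕ.+ m) * v (k ℕ.+ m))
        ≈⟨ *-congʳ (A-B m k) ⟩
      (Z m * B m k) * (z m * Z (suc k ℕ.+ m) * v (k ℕ.+ m))
        ≈⟨ *-assoc _ _ _ ⟩
      Z m * B m (suc k) ∎

    -- Replacing y by yx² turns y^k into x^(2k) y^k, and the numerator becomes that of `B m k`. The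
    -- denominator (yx; x²)_k loses its first factor `W m` and gains 1 - yx^(2k+1), which
    -- `v (k + m)` inverts.
    A-suc : ∀ m k → A (suc m) k ≈ t k * W m * B m k * v (k ℕ.+ m)
    A-suc m zero    = begin
      1#                       ≈⟨ inv-inverse (suc m ℕ.* 2 ℕ.* 2) ⟨
      v m * W m                ≈⟨ *-comm (v m) (W m) ⟩
      W m * v m                ≈⟨ *-congʳ (trans (*-identityʳ _) (*-identityˡ (W m))) ⟨
      1# * W m * 1# * v m      ∎
    A-suc m (suc k) rewrite ℕ.+-suc k m = begin
      A (suc m) k * (z (suc m) * Z (suc (k ℕ.+ m)) * v (suc (k ℕ.+ m)))
        ≈⟨ *-congʳ (A-suc m k) ⟩
      t k * W m * B m k * v (k ℕ.+ m) * (z (suc m) * Z (suc (k ℕ.+ m)) * v (suc (k ℕ.+ m)))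
        ≈⟨ solve 7 (λ t y b v z y′ v′ → t :* y :* b :* v :* (z :* y′ :* v′)
                                     := (t :* z) :* y :* (b :* (y′ :* v)) :* v′)
             refl (t k) (W m) (B m k) (v (k ℕ.+ m)) (z (suc m)) (Z (suc (k ℕ.+ m))) (v (suc (k ℕ.+ m))) ⟩
      (t k * z (suc m)) * W m * (B m k * (Z (suc (k ℕ.+ m)) * v (k ℕ.+ m))) * v (suc (k ℕ.+ m))
        ≈⟨ *-congʳ (*-congʳ (*-congʳ 
          (^-shuffle (k ℕ.* 4) (suc (suc m ℕ.* 2) ℕ.* 2) (suc k ℕ.* 4) (suc (m ℕ.* 2) ℕ.* 2) (exponents k m)))) ⟩
      (t (suc k) * z m) * W m * (B m k * (Z (suc (k ℕ.+ m)) * v (k ℕ.+ m))) * v (suc (k ℕ.+ m))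
        ≈⟨ solve 7 (λ t y b v z y′ v′ → (t :* z) :* y :* (b :* (y′ :* v)) :* v′
                                     := t :* y :* (b :* (z :* y′ :* v)) :* v′)
             refl (t (suc k)) (W m) (B m k) (v (k ℕ.+ m)) (z m) (Z (suc (k ℕ.+ m))) (v (suc (k ℕ.+ m))) ⟩
      t (suc k) * W m * B m (suc k) * v (suc (k ℕ.+ m)) ∎
      where
      exponents : ∀ k m → k ℕ.* 4 ℕ.+ suc (suc m ℕ.* 2) ℕ.* 2 ≡ suc k ℕ.* 4 ℕ.+ suc (m ℕ.* 2) ℕ.* 2
      exponents = ℕ-solve-∀

    -- Both sides are 1 - z m * z (suc (k + m)).
    coefficient : ∀ m k → Z m + z m * Z (suc (k ℕ.+ m)) ≈ W (k ℕ.+ m) + w m * t k * W m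
    coefficient m k = +-cancelʳ (z m * z (suc (k ℕ.+ m))) _ _ (begin
      Z m + z m * Z (suc (k ℕ.+ m)) + z m * z (suc (k ℕ.+ m))
        ≈⟨ solve 4 (λ y z y′ z′ → y :+ z :* y′ :+ z :* z′ := y :+ z :* (y′ :+ z′))
             refl (Z m) (z m) (Z (suc (k ℕ.+ m))) (z (suc (k ℕ.+ m))) ⟩
      Z m + z m * (Z (suc (k ℕ.+ m)) + z (suc (k ℕ.+ m)))
        ≈⟨ +-congˡ (trans (*-congˡ (complement _)) (*-identityʳ _)) ⟩
      Z m + z m
        ≈⟨ complement (z m) ⟩
      1#
        ≈⟨ complement (w (k ℕ.+ m)) ⟨
      W (k ℕ.+ m) + w (k ℕ.+ m)
        ≈⟨ +-congˡ (trans (*-congˡ (complement (w m))) (*-identityʳ _)) ⟨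
      W (k ℕ.+ m) + w (k ℕ.+ m) * (W m + w m)
        ≈⟨ solve 4 (λ y w′ y′ w → y :+ w′ :* (y′ :+ w) := y :+ w′ :* y′ :+ w′ :* w)
             refl (W (k ℕ.+ m)) (w (k ℕ.+ m)) (W m) (w m) ⟩
      W (k ℕ.+ m) + w (k ℕ.+ m) * W m + w (k ℕ.+ m) * w m
        ≈⟨ +-cong (+-congˡ (*-congʳ wt)) 
           (^-shuffle (suc (k ℕ.+ m) ℕ.* 2 ℕ.* 2) (suc m ℕ.* 2 ℕ.* 2) (suc (m ℕ.* 2) ℕ.* 2)
              (suc (suc (k ℕ.+ m) ℕ.* 2) ℕ.* 2) (exponents k m)) ⟩
      W (k ℕ.+ m) + w m * t k * W m + z m * z (suc (k ℕ.+ m)) ∎)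
      where
      exponents : ∀ k m → suc (k ℕ.+ m) ℕ.* 2 ℕ.* 2 ℕ.+ suc m ℕ.* 2 ℕ.* 2
                        ≡ suc (m ℕ.* 2) ℕ.* 2 ℕ.+ suc (suc (k ℕ.+ m) ℕ.* 2) ℕ.* 2
      exponents = ℕ-solve-∀
      exponents′ : ∀ k m → suc (k ℕ.+ m) ℕ.* 2 ℕ.* 2 ≡ suc m ℕ.* 2 ℕ.* 2 ℕ.+ k ℕ.* 4
      exponents′ = ℕ-solve-∀
      wt : w (k ℕ.+ m) ≈ w m * t k
      wt = trans (reflexive (≡.cong (q ^_) (exponents′ k m))) (^-homo-* q (suc m ℕ.* 2 ℕ.* 2) (k ℕ.* 4))

    -- Rearranged, it expresses `A m (suc k) - z m * w m * A (suc m) k` as the difference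
    -- `z m * B m k - z m * B m (suc k)`, which telescopes when summed over k. By `A-B` and `A-suc`
    -- every term is a multiple of `B m k * z m * v (k + m)`, and `coefficient` compares the
    -- cofactors.
    telescope : ∀ m k → A m (suc k) + z m * B m (suc k) ≈ z m * B m k + z m * w m * A (suc m) k
    telescope m k = begin
      A m k * (z m * Z (k ℕ.+ m) * v (k ℕ.+ m)) + z m * B m (suc k)
        ≈⟨ +-congʳ (solve 4 (λ a z y v → a :* (z :* y :* v) := (a :* y) :* (z :* v))
             refl (A m k) (z m) (Z (k ℕ.+ m)) (v (k ℕ.+ m))) ⟩
      (A m k * Z (k ℕ.+ m)) * (z m * v (k ℕ.+ m)) + z m * B m (suc k)
        ≈⟨ +-congʳ (*-congʳ (A-B m k)) ⟩
      (Z m * B m k) * (z m * v (k ℕ.+ m)) + z m * (B m k * (z m * Z (suc (k ℕ.+ m)) * v (k ℕ.+ m)))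
        ≈⟨ solve 5 (λ y b z v y′ → (y :* b) :* (z :* v) :+ z :* (b :* (z :* y′ :* v))
                                 := (b :* z :* v) :* (y :+ z :* y′))
             refl (Z m) (B m k) (z m) (v (k ℕ.+ m)) (Z (suc (k ℕ.+ m))) ⟩
      (B m k * z m * v (k ℕ.+ m)) * (Z m + z m * Z (suc (k ℕ.+ m)))
        ≈⟨ *-congˡ (coefficient m k) ⟩
      (B m k * z m * v (k ℕ.+ m)) * (W (k ℕ.+ m) + w m * t k * W m)
        ≈⟨ solve 7 (λ b z v y w t y′ → (b :* z :* v) :* (y :+ w :* t :* y′)
                                     := z :* b :* (v :* y) :+ z :* w :* (t :* y′ :* b :* v))
             refl (B m k) (z m) (v (k ℕ.+ m)) (W (k ℕ.+ m)) (w m) (t k) (W m) ⟩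
      z m * B m k * (v (k ℕ.+ m) * W (k ℕ.+ m)) + z m * w m * (t k * W m * B m k * v (k ℕ.+ m))
        ≈⟨ +-cong (trans (*-congˡ (inv-inverse (suc (k ℕ.+ m) ℕ.* 2 ℕ.* 2))) (*-identityʳ _))
                  (*-congˡ (sym (A-suc m k))) ⟩
      z m * B m k + z m * w m * A (suc m) k ∎

    partialSum : ℕ → ℕ → Carrier
    partialSum m zero    = 0#
    partialSum m (suc K) = partialSum m K + A m K

    -- The terms 1 and `z m` on the right are `A m 0` and `z m * B m 0`, the start of the
    -- telescoping; `z m * B m K` is its end.
    rogersFine : ∀ m K → partialSum m (suc K) + z m * B m K
                       ≈ 1# + z m + z m * w m * partialSum (suc m) K
    rogersFine m zero    = trans
      (solve 3 (λ o z w → con 0 :+ o :+ z :* o := o :+ z :* o :+ z :* w :* con 0) refl 1# (z m) (w m))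
      (+-congʳ (+-congˡ (*-identityʳ (z m))))
    rogersFine m (suc K) = begin
      partialSum m (suc K) + A m (suc K) + z m * B m (suc K)
        ≈⟨ +-assoc _ _ _ ⟩
      partialSum m (suc K) + (A m (suc K) + z m * B m (suc K))
        ≈⟨ +-congˡ (telescope m K) ⟩
      partialSum m (suc K) + (z m * B m K + z m * w m * A (suc m) K)
        ≈⟨ +-assoc _ _ _ ⟨
      partialSum m (suc K) + z m * B m K + z m * w m * A (suc m) K
        ≈⟨ +-congʳ (rogersFine m K) ⟩
      1# + z m + z m * w m * partialSum (suc m) K + z m * w m * A (suc m) K
        ≈⟨ solve 4 (λ o c s a → o :+ c :* s :+ c :* a := o :+ c :* (s :+ a))
             refl (1# + z m) (z m * w m) (partialSum (suc m) K) (A (suc m) K) ⟩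
      1# + z m + z m * w m * partialSum (suc m) (suc K) ∎

    -- The index of each sequence is a bound on the parts, and the hypotheses say what happens when
    -- the bound rises by one. `E` stands for partitions into even parts of even multiplicity: these
    -- are what may lie below a largest even part counted by `EO`.
    module _ (P Pod E EO : ℕ → Carrier)
      (P-zero : P 0 ≈ 1#) (P-suc : ∀ k → P (suc k) ≈ inv (suc k) * P k)
      (Pod-zero : Pod 0 ≈ 1#)
      (Pod-odd : ∀ K → Pod (suc (K ℕ.* 2)) ≈ Pod (K ℕ.* 2) + q ^ suc (K ℕ.* 2) * Pod (K ℕ.* 2))
      (Pod-even : ∀ K → Pod (suc K ℕ.* 2) ≈ inv (suc K ℕ.* 2) * Pod (suc (K ℕ.* 2)))
      (E-zero : E 0 ≈ 1#)
      (E-odd : ∀ K → E (suc (K ℕ.* 2)) ≈ E (K ℕ.* 2))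
      (E-even : ∀ K → E (suc K ℕ.* 2) ≈ v K * E (suc (K ℕ.* 2)))
      (EO-zero : EO 0 ≈ 1#)
      (EO-odd : ∀ K → EO (suc (K ℕ.* 2)) ≈ u K * EO (K ℕ.* 2))
      (EO-even : ∀ K → EO (suc K ℕ.* 2) ≈ EO (suc (K ℕ.* 2)) + q ^ (suc K ℕ.* 2) * (v K * E (suc (K ℕ.* 2))))
      where

      D : ℕ → Carrier
      D zero    = 1#
      D (suc K) = D K * u K

      Pod-D : ∀ K → Pod (K ℕ.* 2) * D K ≈ P (K ℕ.* 2)
      Pod-D zero    = trans (*-identityʳ _) (trans Pod-zero (sym P-zero))
      Pod-D (suc K) = begin
        Pod (suc K ℕ.* 2) * (D K * u K)
          ≈⟨ *-congʳ (trans (Pod-even K) (*-congˡ (Pod-odd K))) ⟩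
        i * (Pod (K ℕ.* 2) + x * Pod (K ℕ.* 2)) * (D K * u K)
          ≈⟨ solve 5 (λ i p x d u → i :* (p :+ x :* p) :* (d :* u) := i :* ((u :+ x :* u) :* (p :* d)))
               refl i (Pod (K ℕ.* 2)) x (D K) (u K) ⟩
        i * ((u K + x * u K) * (Pod (K ℕ.* 2) * D K))
          ≈⟨ *-congˡ (*-cong (inv-double (suc (K ℕ.* 2))) (Pod-D K)) ⟩
        i * (inv (suc (K ℕ.* 2)) * P (K ℕ.* 2))
          ≈⟨ trans (P-suc _) (*-congˡ (P-suc _)) ⟨
        P (suc K ℕ.* 2) ∎
        where
        i x : Carrier
        i = inv (suc K ℕ.* 2)
        x = q ^ suc (K ℕ.* 2)

      -- The factors of `D K` cancel the numerator (x; x²)_K of `A 0 K`. What is left, x^K / (x²;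
      -- x²)_K, describes partitions from `E` with one extra copy of the part 2K.
      D-A : ∀ K → D K * A 0 K ≈ q ^ (K ℕ.* 2) * E (K ℕ.* 2)
      D-A zero    = *-congˡ (sym E-zero)
      D-A (suc K) rewrite ℕ.+-identityʳ K = begin
        D K * u K * (A 0 K * (z 0 * Z K * v K))
          ≈⟨ solve 6 (λ d u a z y v → d :* u :* (a :* (z :* y :* v)) := (d :* a) :* (z :* v) :* (u :* y))
               refl (D K) (u K) (A 0 K) (z 0) (Z K) (v K) ⟩
        (D K * A 0 K) * (z 0 * v K) * (u K * Z K)
          ≈⟨ *-cong (*-congʳ (D-A K)) (inv-inverse (suc (K ℕ.* 2) ℕ.* 2)) ⟩
        (q ^ (K ℕ.* 2) * E (K ℕ.* 2)) * (z 0 * v K) * 1#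
          ≈⟨ *-identityʳ _ ⟩
        (q ^ (K ℕ.* 2) * E (K ℕ.* 2)) * (z 0 * v K)
          ≈⟨ solve 4 (λ x e z v → (x :* e) :* (z :* v) := (z :* x) :* (v :* e))
               refl (q ^ (K ℕ.* 2)) (E (K ℕ.* 2)) (z 0) (v K) ⟩
        (z 0 * q ^ (K ℕ.* 2)) * (v K * E (K ℕ.* 2))
          ≈⟨ *-cong (^-homo-* q 2 (K ℕ.* 2)) (trans (E-even K) (*-congˡ (E-odd K))) ⟨
        q ^ (suc K ℕ.* 2) * E (suc K ℕ.* 2) ∎

      -- Allowing the part 2K + 1 multiplies by `u K`, the new factor of `D`. Allowing 2K + 2 adds
      -- the partitions in which it is the largest even part, and by `D-A` these are the new summand
      -- of the partial sum.
      EO-D : ∀ K → EO (K ℕ.* 2) ≈ D K * partialSum 0 (suc K)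
      EO-D zero    = trans EO-zero (sym (trans (*-identityˡ _) (+-identityˡ 1#)))
      EO-D (suc K) = begin
        EO (suc K ℕ.* 2)
          ≈⟨ EO-even K ⟩
        EO (suc (K ℕ.* 2)) + q ^ (suc K ℕ.* 2) * (v K * E (suc (K ℕ.* 2)))
          ≈⟨ +-cong (trans (EO-odd K) (*-congˡ (EO-D K)))
                    (trans (*-congˡ (sym (E-even K))) (sym (D-A (suc K)))) ⟩
        u K * (D K * partialSum 0 (suc K)) + D K * u K * A 0 (suc K)
          ≈⟨ solve 4 (λ u d s a → u :* (d :* s) :+ d :* u :* a := d :* u :* (s :+ a))
               refl (u K) (D K) (partialSum 0 (suc K)) (A 0 (suc K)) ⟩
        D (suc K) * partialSum 0 (suc (suc K)) ∎

      Pod-EO : ∀ K → Pod (K ℕ.* 2) * EO (K ℕ.* 2) ≈ P (K ℕ.* 2) * partialSum 0 (suc K)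
      Pod-EO K = begin
        Pod (K ℕ.* 2) * EO (K ℕ.* 2)                        ≈⟨ *-congˡ (EO-D K) ⟩
        Pod (K ℕ.* 2) * (D K * partialSum 0 (suc K))       ≈⟨ *-assoc _ _ _ ⟨
        Pod (K ℕ.* 2) * D K * partialSum 0 (suc K)         ≈⟨ *-congʳ (Pod-D K) ⟩
        P (K ℕ.* 2) * partialSum 0 (suc K)                 ∎

-- Formal power series

open import Data.Integer as ℤ using (ℤ; +_; -[1+_]; _-_)

Series : Set
Series = ℕ → ℤ

infix 4 _≈_
infixl 6 _⊕_
infixl 7 _⊛_

record _≈_ (f g : Series) : Set where
  constructor pointwise
  field coeff : ∀ n → f n ≡ g n
open _≈_

⊖_ : Series → Series
(⊖ f) n = ℤ.- f n

𝟘 𝟙 : Series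
𝟘 _       = + 0
𝟙 zero    = + 1
𝟙 (suc _) = + 0

-- Opaque, so that unification can recover f and g from f ⊕ g instead of comparing coefficients.
opaque
  _⊕_ _⊛_ : Series → Series → Series
  (f ⊕ g) n       = f n ℤ.+ g n
  (f ⊛ g) zero    = f 0 ℤ.* g 0
  (f ⊛ g) (suc n) = f 0 ℤ.* g (suc n) ℤ.+ ((f ∘ suc) ⊛ g) n

opaque
  unfolding _⊕_ _⊛_

  ⊕-coeff : ∀ f g n → (f ⊕ g) n ≡ f n ℤ.+ g n
  ⊕-coeff f g n = ≡.refl

  ⊛-zero-coeff : ∀ f g → (f ⊛ g) 0 ≡ f 0 ℤ.* g 0
  ⊛-zero-coeff f g = ≡.refl

  ⊛-suc-coeff : ∀ f g n → (f ⊛ g) (suc n) ≡ f 0 ℤ.* g (suc n) ℤ.+ ((f ∘ suc) ⊛ g) n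
  ⊛-suc-coeff f g n = ≡.refl

  -- The convolution at n reads no coefficient beyond n. Keeping the bound in the hypotheses also
  -- makes products respect agreement below a truncation.
  ⊛-cong-upTo : ∀ {f f′ g g′} n → (∀ k → k ℕ.≤ n → f k ≡ f′ k) → (∀ k → k ℕ.≤ n → g k ≡ g′ k) →
                (f ⊛ g) n ≡ (f′ ⊛ g′) n
  ⊛-cong-upTo zero    f≡ g≡ = ≡.cong₂ ℤ._*_ (f≡ 0 z≤n) (g≡ 0 z≤n)
  ⊛-cong-upTo (suc n) f≡ g≡ = ≡.cong₂ ℤ._+_
    (≡.cong₂ ℤ._*_ (f≡ 0 z≤n) (g≡ (suc n) ℕ.≤-refl))
    (⊛-cong-upTo n (λ k k≤n → f≡ (suc k) (s≤s k≤n)) (λ k k≤n → g≡ k (ℕ.m≤n⇒m≤1+n k≤n)))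

  ⊛-cong : ∀ {f f′ g g′} → f ≈ f′ → g ≈ g′ → f ⊛ g ≈ f′ ⊛ g′
  ⊛-cong f≈ g≈ = pointwise λ n → ⊛-cong-upTo n (λ k _ → coeff f≈ k) (λ k _ → coeff g≈ k)

  -- The definition splits off the term with `f 0`; commutativity needs the mirror image, which
  -- splits off the term with `g 0`.
  ⊛-suc : ∀ f g n → (f ⊛ g) (suc n) ≡ (f ⊛ (g ∘ suc)) n ℤ.+ f (suc n) ℤ.* g 0
  ⊛-suc f g zero    = ≡.refl
  ⊛-suc f g (suc n) = ≡.trans
    (≡.cong (λ i → f 0 ℤ.* g (suc (suc n)) ℤ.+ i) (⊛-suc (f ∘ suc) g n))
    (≡.sym (ℤ.+-assoc (f 0 ℤ.* g (suc (suc n))) (((f ∘ suc) ⊛ (g ∘ suc)) n) (f (suc (suc n)) ℤ.* g 0)))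

  ⊛-comm-coeff : ∀ f g n → (f ⊛ g) n ≡ (g ⊛ f) n
  ⊛-comm-coeff f g zero    = ℤ.*-comm (f 0) (g 0)
  ⊛-comm-coeff f g (suc n) = begin
    f 0 ℤ.* g (suc n) ℤ.+ ((f ∘ suc) ⊛ g) n
      ≡⟨ ≡.cong₂ ℤ._+_ (ℤ.*-comm (f 0) (g (suc n))) (⊛-comm-coeff (f ∘ suc) g n) ⟩
    g (suc n) ℤ.* f 0 ℤ.+ (g ⊛ (f ∘ suc)) n
      ≡⟨ ℤ.+-comm (g (suc n) ℤ.* f 0) _ ⟩
    (g ⊛ (f ∘ suc)) n ℤ.+ g (suc n) ℤ.* f 0
      ≡⟨ ⊛-suc g f n ⟨
    (g ⊛ f) (suc n) ∎
    where open ≡-Reasoning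

  ⊛-distribʳ-coeff : ∀ h f g n → ((f ⊕ g) ⊛ h) n ≡ (f ⊛ h) n ℤ.+ (g ⊛ h) n
  ⊛-distribʳ-coeff h f g zero    = ℤ.*-distribʳ-+ (h 0) (f 0) (g 0)
  ⊛-distribʳ-coeff h f g (suc n) = ≡.trans
    (≡.cong (λ i → (f 0 ℤ.+ g 0) ℤ.* h (suc n) ℤ.+ i) (⊛-distribʳ-coeff h (f ∘ suc) (g ∘ suc) n))
    (rearrange (f 0) (g 0) (h (suc n)) (((f ∘ suc) ⊛ h) n) (((g ∘ suc) ⊛ h) n))
    where
    rearrange : ∀ a b c x y → (a ℤ.+ b) ℤ.* c ℤ.+ (x ℤ.+ y) ≡ (a ℤ.* c ℤ.+ x) ℤ.+ (b ℤ.* c ℤ.+ y)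
    rearrange = ℤ-solve-∀

  ⊛-scale : ∀ c f g n → ((λ k → c ℤ.* f k) ⊛ g) n ≡ c ℤ.* (f ⊛ g) n
  ⊛-scale c f g zero    = ℤ.*-assoc c (f 0) (g 0)
  ⊛-scale c f g (suc n) = ≡.trans
    (≡.cong (λ i → c ℤ.* f 0 ℤ.* g (suc n) ℤ.+ i) (⊛-scale c (f ∘ suc) g n))
    (rearrange c (f 0) (g (suc n)) (((f ∘ suc) ⊛ g) n))
    where
    rearrange : ∀ c a b x → c ℤ.* a ℤ.* b ℤ.+ c ℤ.* x ≡ c ℤ.* (a ℤ.* b ℤ.+ x)
    rearrange = ℤ-solve-∀

  ⊛-assoc-coeff : ∀ f g h n → ((f ⊛ g) ⊛ h) n ≡ (f ⊛ (g ⊛ h)) n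
  ⊛-assoc-coeff f g h zero    = ℤ.*-assoc (f 0) (g 0) (h 0)
  ⊛-assoc-coeff f g h (suc n) = begin
    -- The shifted product `(f ⊛ g) ∘ suc` unfolds to a scalar multiple of `g ∘ suc` plus
    -- `(f ∘ suc) ⊛ g`, so distributivity and scaling apply.
    f 0 ℤ.* g 0 ℤ.* h (suc n) ℤ.+ (((λ k → f 0 ℤ.* g (suc k)) ⊕ ((f ∘ suc) ⊛ g)) ⊛ h) n
      ≡⟨ ≡.cong (λ i → f 0 ℤ.* g 0 ℤ.* h (suc n) ℤ.+ i) (≡.trans
           (⊛-distribʳ-coeff h (λ k → f 0 ℤ.* g (suc k)) ((f ∘ suc) ⊛ g) n)
           (≡.cong₂ ℤ._+_ (⊛-scale (f 0) (g ∘ suc) h n) (⊛-assoc-coeff (f ∘ suc) g h n))) ⟩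
    f 0 ℤ.* g 0 ℤ.* h (suc n) ℤ.+ (f 0 ℤ.* ((g ∘ suc) ⊛ h) n ℤ.+ ((f ∘ suc) ⊛ (g ⊛ h)) n)
      ≡⟨ rearrange (f 0) (g 0) (h (suc n)) _ _ ⟩
    f 0 ℤ.* (g 0 ℤ.* h (suc n) ℤ.+ ((g ∘ suc) ⊛ h) n) ℤ.+ ((f ∘ suc) ⊛ (g ⊛ h)) n ∎
    where
    open ≡-Reasoning
    rearrange : ∀ a b c x y → a ℤ.* b ℤ.* c ℤ.+ (a ℤ.* x ℤ.+ y) ≡ a ℤ.* (b ℤ.* c ℤ.+ x) ℤ.+ y
    rearrange = ℤ-solve-∀

  ⊛-zeroˡ-coeff : ∀ f n → (𝟘 ⊛ f) n ≡ + 0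
  ⊛-zeroˡ-coeff f zero    = ≡.refl
  ⊛-zeroˡ-coeff f (suc n) = ≡.trans (ℤ.+-identityˡ _) (⊛-zeroˡ-coeff f n)

  ⊛-identityˡ-coeff : ∀ f n → (𝟙 ⊛ f) n ≡ f n
  ⊛-identityˡ-coeff f zero    = ℤ.*-identityˡ (f 0)
  ⊛-identityˡ-coeff f (suc n) = ≡.trans
    (≡.cong₂ ℤ._+_ (ℤ.*-identityˡ (f (suc n))) (⊛-zeroˡ-coeff f n)) (ℤ.+-identityʳ (f (suc n)))

  isCommutativeRing : IsCommutativeRing _≈_ _⊕_ _⊛_ ⊖_ 𝟘 𝟙
  isCommutativeRing = record
    { isRing = record
      { +-isAbelianGroup = record
        { isGroup = record
          { isMonoid = record
            { isSemigroup = record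
              { isMagma = record
                { isEquivalence = record
                  { refl  = pointwise λ _ → ≡.refl
                  ; sym   = λ f≈g → pointwise λ n → ≡.sym (coeff f≈g n)
                  ; trans = λ f≈g g≈h → pointwise λ n → ≡.trans (coeff f≈g n) (coeff g≈h n)
                  }
                ; ∙-cong = λ f≈ g≈ → pointwise λ n → ≡.cong₂ ℤ._+_ (coeff f≈ n) (coeff g≈ n)
                }
              ; assoc = λ f g h → pointwise λ n → ℤ.+-assoc (f n) (g n) (h n)
              }
            ; identity = (λ f → pointwise λ n → ℤ.+-identityˡ (f n))
                       , (λ f → pointwise λ n → ℤ.+-identityʳ (f n))
            }
          ; inverse = (λ f → pointwise λ n → ℤ.+-inverseˡ (f n))
                    , (λ f → pointwise λ n → ℤ.+-inverseʳ (f n))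
          ; ⁻¹-cong = λ f≈ → pointwise λ n → ≡.cong ℤ.-_ (coeff f≈ n)
          }
        ; comm = λ f g → pointwise λ n → ℤ.+-comm (f n) (g n)
        }
      ; *-cong = ⊛-cong
      ; *-assoc = λ f g h → pointwise (⊛-assoc-coeff f g h)
      ; *-identity = (λ f → pointwise (⊛-identityˡ-coeff f))
                   , (λ f → pointwise λ n → ≡.trans (⊛-comm-coeff f 𝟙 n) (⊛-identityˡ-coeff f n))
      ; distrib = (λ f g h → pointwise λ n → ≡.trans (⊛-comm-coeff f (g ⊕ h) n) (≡.trans
                    (⊛-distribʳ-coeff f g h n)
                    (≡.cong₂ ℤ._+_ (⊛-comm-coeff g f n) (⊛-comm-coeff h f n))))
                , (λ h f g → pointwise (⊛-distribʳ-coeff h f g))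
      }
    ; *-comm = λ f g → pointwise (⊛-comm-coeff f g)
    }

seriesRing : CommutativeRing 0ℓ 0ℓ
seriesRing = record { isCommutativeRing = isCommutativeRing }

q : Series
q zero          = + 0
q (suc zero)    = + 1
q (suc (suc _)) = + 0

open CommutativeRing seriesRing
  using (setoid; semiring; *-commutativeSemigroup)
  renaming
  ( refl to ≈-refl; sym to ≈-sym; trans to ≈-trans
  ; +-cong to ⊕-cong; +-congˡ to ⊕-congˡ; +-assoc to ⊕-assoc
  ; +-identityˡ to ⊕-identityˡ; +-identityʳ to ⊕-identityʳ
  ; *-congˡ to ⊛-congˡ; *-congʳ to ⊛-congʳ; *-assoc to ⊛-assoc; *-comm to ⊛-comm
  ; *-identityˡ to ⊛-identityˡ; *-identityʳ to ⊛-identityʳ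
  ; zeroˡ to ⊛-zeroˡ; zeroʳ to ⊛-zeroʳ; distribˡ to ⊛-distribˡ; distribʳ to ⊛-distribʳ
  )
open CommutativeSemigroupProperties *-commutativeSemigroup using (x∙yz≈y∙xz)
open Exp semiring using (_^_; ^-homo-*)

opaque
  unfolding _⊕_ _⊛_

  q⊛-suc : ∀ f n → (q ⊛ f) (suc n) ≡ f n
  q⊛-suc f n = ≡.trans (ℤ.+-identityˡ _)
    -- The shifted series `q ∘ suc` has the coefficients of 𝟙.
    (≡.trans (⊛-cong-upTo n (λ { zero _ → ≡.refl ; (suc _) _ → ≡.refl }) (λ _ _ → ≡.refl))
             (⊛-identityˡ-coeff f n))

  q⊛-zero : ∀ f → (q ⊛ f) zero ≡ + 0
  q⊛-zero f = ≡.refl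

q^⊛-suc : ∀ a f n → (q ^ suc a ⊛ f) (suc n) ≡ (q ^ a ⊛ f) n
q^⊛-suc a f n = ≡.trans (⊛-assoc-coeff q (q ^ a) f (suc n)) (q⊛-suc (q ^ a ⊛ f) n)

q^⊛-< : ∀ a f n → n ℕ.< a → (q ^ a ⊛ f) n ≡ + 0
q^⊛-< (suc a) f zero    _         = ≡.trans (⊛-assoc-coeff q (q ^ a) f zero) (q⊛-zero (q ^ a ⊛ f))
q^⊛-< (suc a) f (suc n) (s≤s n<a) = ≡.trans (q^⊛-suc a f n) (q^⊛-< a f n n<a)

q^⊛-≥ : ∀ a f n → a ℕ.≤ n → (q ^ a ⊛ f) n ≡ f (n ℕ.∸ a)
q^⊛-≥ zero    f n       _         = ⊛-identityˡ-coeff f n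
q^⊛-≥ (suc a) f (suc n) (s≤s a≤n) = ≡.trans (q^⊛-suc a f n) (q^⊛-≥ a f n a≤n)

-- Agreement of power series below a given exponent

infix 4 _≈[_]_

_≈[_]_ : Series → ℕ → Series → Set
f ≈[ N ] g = ∀ n → n ℕ.< N → f n ≡ g n

≈⇒≈[] : ∀ {f g N} → f ≈ g → f ≈[ N ] g
≈⇒≈[] f≈g n _ = coeff f≈g n

opaque
  unfolding _⊕_ _⊛_

  ⊕-cong[] : ∀ {f f′ g g′ N} → f ≈[ N ] f′ → g ≈[ N ] g′ → f ⊕ g ≈[ N ] f′ ⊕ g′
  ⊕-cong[] f≈ g≈ n n< = ≡.cong₂ ℤ._+_ (f≈ n n<) (g≈ n n<)

  ⊛-cong[] : ∀ {f f′ g g′ N} → f ≈[ N ] f′ → g ≈[ N ] g′ → f ⊛ g ≈[ N ] f′ ⊛ g′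
  ⊛-cong[] f≈ g≈ n n< = ⊛-cong-upTo n (λ k k≤n → f≈ k (ℕ.≤-<-trans k≤n n<)) (λ k k≤n → g≈ k (ℕ.≤-<-trans k≤n n<))

-- The factor `q ^ a` moves the range of agreement up by a. This gain, which `⊛-cong[]` does not
-- record, is what makes remainders disappear.
q^⊛-cong[] : ∀ a {c f g} → f ≈[ c ] g → q ^ a ⊛ f ≈[ a ℕ.+ c ] q ^ a ⊛ g
q^⊛-cong[] zero    {f = f} {g} f≈ n n< =
  ≡.trans (⊛-identityˡ-coeff f n) (≡.trans (f≈ n n<) (≡.sym (⊛-identityˡ-coeff g n)))
q^⊛-cong[] (suc a) {f = f} {g} f≈ zero n< =
  ≡.trans (q^⊛-< (suc a) f 0 (s≤s z≤n)) (≡.sym (q^⊛-< (suc a) g 0 (s≤s z≤n)))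
q^⊛-cong[] (suc a) {f = f} {g} f≈ (suc n) (s≤s n<) =
  ≡.trans (q^⊛-suc a f n) (≡.trans (q^⊛-cong[] a f≈ n n<) (≡.sym (q^⊛-suc a g n)))

-- Generating functions of restricted partitions

∑< : ℕ → (ℕ → ℤ) → ℤ
∑< zero    f = + 0
∑< (suc N) f = f 0 ℤ.+ ∑< N (f ∘ suc)

∑<-cong : ∀ N {f g} → (∀ m → f m ≡ g m) → ∑< N f ≡ ∑< N g
∑<-cong zero    f≡g = ≡.refl
∑<-cong (suc N) f≡g = ≡.cong₂ ℤ._+_ (f≡g 0) (∑<-cong N (f≡g ∘ suc))

opaque
  unfolding _⊕_

  -- The coefficients of Σ_m q^(m a) c_m.
  blocks : (a : ℕ) .{{_ : NonZero a}} → (ℕ → Series) → Series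
  blocks a c n = ∑< (suc (n ℕ./ a)) (λ m → c m (n ℕ.∸ m ℕ.* a))

  blocks-cong : ∀ a .{{_ : NonZero a}} {c d} → (∀ m → c m ≈ d m) → blocks a c ≈ blocks a d
  blocks-cong a c≈d = pointwise λ n →
    ∑<-cong (suc (n ℕ./ a)) (λ m → _≈_.coeff (c≈d m) (n ℕ.∸ m ℕ.* a))

  -- For n < a only the multiplicity 0 occurs. Otherwise n / a = 1 + (n ∸ a) / a, and the terms
  -- after the first are a block sum evaluated at n ∸ a.
  blocks-unfold : ∀ a .{{_ : NonZero a}} c → blocks a c ≈ c 0 ⊕ q ^ a ⊛ blocks a (c ∘ suc)
  blocks-unfold a c = pointwise unfold
    where
    unfold : ∀ n → blocks a c n ≡ (c 0 ⊕ q ^ a ⊛ blocks a (c ∘ suc)) n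
    unfold n with n ℕ.<? a
    ... | yes n<a rewrite ℕ.m<n⇒m/n≡0 n<a =
      ≡.cong (λ i → c 0 n ℤ.+ i) (≡.sym (q^⊛-< a (blocks a (c ∘ suc)) n n<a))
    ... | no  n≮a rewrite ℕ.m/n≡1+[m∸n]/n (ℕ.≮⇒≥ n≮a) =
      ≡.cong (λ i → c 0 n ℤ.+ i) (≡.trans
        (∑<-cong (suc ((n ℕ.∸ a) ℕ./ a)) λ m → ≡.cong (c (suc m)) (≡.sym (ℕ.∸-+-assoc n a (m ℕ.* a))))
        (≡.sym (q^⊛-≥ a (blocks a (c ∘ suc)) n (ℕ.≮⇒≥ n≮a))))

inv : (a : ℕ) .{{_ : NonZero a}} → Series
inv a = blocks a (const 𝟙)

inv-unfold : ∀ a .{{_ : NonZero a}} → inv a ≈ 𝟙 ⊕ q ^ a ⊛ inv a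
inv-unfold a = blocks-unfold a (const 𝟙)

open RogersFine seriesRing using (module Identities)
open Identities q inv inv-unfold

blocks-const : ∀ a .{{_ : NonZero a}} f → blocks a (const f) ≈ inv a ⊛ f
blocks-const a f = inv-unique a (blocks-unfold a (const f))

-- The contributions of a part that must have even multiplicity, indexed by that multiplicity.
alternate : Series → ℕ → Series
alternate f zero          = f
alternate f (suc zero)    = 𝟘
alternate f (suc (suc m)) = alternate f m

blocks-alternate : ∀ a .{{_ : NonZero a}} .{{_ : NonZero (a ℕ.* 2)}} f →
                   blocks a (alternate f) ≈ inv (a ℕ.* 2) ⊛ f
blocks-alternate a f = inv-unique (a ℕ.* 2) (begin
  c                              ≈⟨ blocks-unfold a (alternate f) ⟩
  f ⊕ q ^ a ⊛ blocks a (alternate f ∘ suc)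
    ≈⟨ ⊕-congˡ (⊛-congˡ (≈-trans (blocks-unfold a (alternate f ∘ suc)) (⊕-identityˡ _))) ⟩
  f ⊕ q ^ a ⊛ (q ^ a ⊛ c)        ≈⟨ ⊕-congˡ (⊛-assoc _ _ _) ⟨
  f ⊕ q ^ a ⊛ q ^ a ⊛ c          ≈⟨ ⊕-congˡ (⊛-congʳ (^-homo-* q a a)) ⟨
  f ⊕ q ^ (a ℕ.+ a) ⊛ c
    ≡⟨ ≡.cong (λ b → f ⊕ q ^ b ⊛ c) (≡.trans (≡.cong (a ℕ.+_) (≡.sym (ℕ.+-identityʳ a))) (ℕ.*-comm 2 a)) ⟩
  f ⊕ q ^ (a ℕ.* 2) ⊛ c          ∎)
  where
  open SetoidReasoning setoid
  c : Series
  c = blocks a (alternate f)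

private variable
  P Q : List ℕ → Set

opaque
  gf : Decidable P → ℕ → Series
  gf P? k n = + length (filter P? (partitions≤ k n))

filter-map : ∀ (P? : Decidable P) (h : List ℕ → List ℕ) xss →
             filter P? (map h xss) ≡ map h (filter (P? ∘ h) xss)
filter-map P? h []         = ≡.refl
filter-map P? h (xs ∷ xss) with P? (h xs)
... | yes _ = ≡.cong (h xs ∷_) (filter-map P? h xss)
... | no  _ = filter-map P? h xss

length-filter-concatMap : ∀ (P? : Decidable P) (h : ℕ → List (List ℕ)) g N →
  + length (filter P? (concatMap h (applyUpTo g N))) ≡ ∑< N (λ m → + length (filter P? (h (g m))))
length-filter-concatMap P? h g zero    = ≡.refl
length-filter-concatMap P? h g (suc N) = begin
  + length (filter P? (h (g 0) ++ rest))
    ≡⟨ ≡.cong (+_ ∘ length) (filter-++ P? (h (g 0)) rest) ⟩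
  + length (filter P? (h (g 0)) ++ filter P? rest)
    ≡⟨ ≡.cong +_ (length-++ (filter P? (h (g 0)))) ⟩
  + (length (filter P? (h (g 0))) ℕ.+ length (filter P? rest))
    ≡⟨ ℤ.pos-+ (length (filter P? (h (g 0)))) _ ⟩
  + length (filter P? (h (g 0))) ℤ.+ + length (filter P? rest)
    ≡⟨ ≡.cong (λ i → + length (filter P? (h (g 0))) ℤ.+ i) (length-filter-concatMap P? h (g ∘ suc) N) ⟩
  ∑< (suc N) (λ m → + length (filter P? (h (g m)))) ∎
  where
  open ≡-Reasoning
  rest : List (List ℕ)
  rest = concatMap h (applyUpTo (g ∘ suc) N)

opaque
  unfolding gf blocks

  -- `partitions≤` is itself built by the multiplicity of its largest allowed part. The recursion
  -- therefore holds for any predicate, provided the removed copies are put back before it is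
  -- tested.
  gf-suc : ∀ (P? : Decidable P) k →
           gf P? (suc k) ≈ blocks (suc k) (λ m → gf (P? ∘ (replicate m (suc k) ++_)) k)
  gf-suc P? k = pointwise λ n → ≡.trans
    (length-filter-concatMap P?
      (λ m → map (replicate m (suc k) ++_) (partitions≤ k (n ℕ.∸ m ℕ.* suc k))) (λ m → m) (suc (n ℕ./ suc k)))
    (∑<-cong (suc (n ℕ./ suc k)) λ m → ≡.cong +_ (≡.trans
      (≡.cong length (filter-map P? (replicate m (suc k) ++_) (partitions≤ k (n ℕ.∸ m ℕ.* suc k))))
      (length-map (replicate m (suc k) ++_)
        (filter (P? ∘ (replicate m (suc k) ++_)) (partitions≤ k (n ℕ.∸ m ℕ.* suc k))))))

partitions≤-bounded : ∀ k n → All (All (ℕ._< suc k)) (partitions≤ k n)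
partitions≤-bounded zero    zero    = [] ∷ []
partitions≤-bounded zero    (suc n) = []
partitions≤-bounded (suc k) n = All.concat⁺ (All.map⁺ (All.universal (λ m → All.map⁺ (All.map
  (λ ys< → All.++⁺ (All.replicate⁺ m ℕ.≤-refl) (All.map ℕ.m≤n⇒m≤1+n ys<))
  (partitions≤-bounded k (n ℕ.∸ m ℕ.* suc k)))) (upTo (suc (n ℕ./ suc k)))))

filter-cong : ∀ (P? : Decidable P) (Q? : Decidable Q) {xss} →
              All (λ xs → (P xs → Q xs) × (Q xs → P xs)) xss → filter P? xss ≡ filter Q? xss
filter-cong P? Q? [] = ≡.refl
filter-cong P? Q? {xs ∷ xss} ((P⇒Q , Q⇒P) ∷ eqs) with P? xs | Q? xs
... | yes _  | yes _  = ≡.cong (xs ∷_) (filter-cong P? Q? eqs)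
... | no _   | no _   = filter-cong P? Q? eqs
... | yes px | no ¬qx = contradiction (P⇒Q px) ¬qx
... | no ¬px | yes qx = contradiction (Q⇒P qx) ¬px

opaque
  unfolding gf

  -- The bound on `ys` is available to the equivalence because copies of `suc k` will stand in
  -- front, where it matters that they are strictly larger than the rest.
  gf-cong : ∀ (P? : Decidable P) (Q? : Decidable Q) k →
            (∀ ys → All (ℕ._< suc k) ys → (P ys → Q ys) × (Q ys → P ys)) → gf P? k ≈ gf Q? k
  gf-cong P? Q? k P⇔Q = pointwise λ n →
    ≡.cong (+_ ∘ length) (filter-cong P? Q? (All.map (P⇔Q _) (partitions≤-bounded k n)))

  gf-none : ∀ (P? : Decidable P) k → (∀ ys → All (ℕ._< suc k) ys → ¬ P ys) → gf P? k ≈ 𝟘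
  gf-none P? k ¬P = pointwise λ n →
    ≡.cong (+_ ∘ length) (filter-none P? (All.map (¬P _) (partitions≤-bounded k n)))

-- Partitions that use the part `suc k` contribute a multiple of q^(suc k), so they do not reach the
-- coefficient at n once n ≤ k.
gf-stable : ∀ (P? : Decidable P) {n k} → n ℕ.≤ k → gf P? k n ≡ gf P? n n
gf-stable P? n≤k = go (ℕ.≤⇒≤′ n≤k)
  where
  go : ∀ {n k} → n ℕ.≤′ k → gf P? k n ≡ gf P? n n
  go ℕ.≤′-refl = ≡.refl
  go {n} {suc k} (ℕ.≤′-step n≤k) = ≡.trans (begin
    gf P? (suc k) n             ≡⟨ _≈_.coeff (≈-trans (gf-suc P? k) (blocks-unfold (suc k) _)) n ⟩
    (gf P? k ⊕ q ^ suc k ⊛ _) n ≡⟨ ⊕-coeff _ _ n ⟩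
    gf P? k n ℤ.+ _             ≡⟨ ≡.cong (λ i → gf P? k n ℤ.+ i) (q^⊛-< (suc k) _ n (s≤s (ℕ.≤′⇒≤ n≤k))) ⟩
    gf P? k n ℤ.+ + 0           ≡⟨ ℤ.+-identityʳ _ ⟩
    gf P? k n                   ∎) (go n≤k)
    where open ≡-Reasoning

opaque
  unfolding gf

  gf-coeff : ∀ (P? : Decidable P) k n → gf P? k n ≡ + length (filter P? (partitions≤ k n))
  gf-coeff P? k n = ≡.refl

  gf-zero : ∀ (P? : Decidable P) → P [] → gf P? 0 ≈ 𝟙
  gf-zero P? P[] = pointwise λ where
    zero    → ≡.cong (+_ ∘ length) (filter-accept P? P[])
    (suc _) → ≡.refl

-- Parity and multiplicities

even-suc² : ∀ {n} → Even n → Even (suc (suc n))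
even-suc² = ∣m∣n⇒∣m+n ∣-refl

even-pred² : ∀ {n} → Even (suc (suc n)) → Even n
even-pred² e = ∣m+n∣m⇒∣n e ∣-refl

odd-suc : ∀ {n} → Even n → Odd (suc n)
odd-suc {zero}        _ e = case ∣1⇒≡1 e of λ ()
odd-suc {suc zero}    e _ = case ∣1⇒≡1 e of λ ()
odd-suc {suc (suc n)} e e′ = odd-suc (even-pred² e) (even-pred² e′)

even-pred : ∀ {n} → Odd (suc n) → Even n
even-pred {zero}        _ = 2 ∣0
even-pred {suc zero}    o = contradiction ∣-refl o
even-pred {suc (suc n)} o = even-suc² (even-pred (o ∘ even-suc²))

even-double : ∀ K → Even (K ℕ.* 2)
even-double K = divides K ≡.refl

≈-alternate : ∀ {c : ℕ → Series} {f} → (∀ m → Even m → c m ≈ f) → (∀ m → Odd m → c m ≈ 𝟘) →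
              ∀ m → c m ≈ alternate f m
≈-alternate e o zero          = e 0 (2 ∣0)
≈-alternate e o (suc zero)    = o 1 (odd-suc (2 ∣0))
≈-alternate e o (suc (suc m)) = ≈-alternate (λ m → e (2 ℕ.+ m) ∘ even-suc²) (λ m odd → o (2 ℕ.+ m) (odd ∘ even-pred²)) m

multiplicity-self : ∀ m a {ys} → All (ℕ._< a) ys → multiplicity a (replicate m a ++ ys) ≡ m
multiplicity-self zero    a ys< = ≡.cong length (filter-none (ℕ._≟ a) (All.map ℕ.<⇒≢ ys<))
multiplicity-self (suc m) a ys< =
  ≡.trans (≡.cong length (filter-accept (ℕ._≟ a) ≡.refl)) (≡.cong suc (multiplicity-self m a ys<))

multiplicity-other : ∀ m {a b} ys → b ℕ.< a → multiplicity b (replicate m a ++ ys) ≡ multiplicity b ys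
multiplicity-other zero    ys b<a = ≡.refl
multiplicity-other (suc m) {b = b} ys b<a =
  ≡.trans (≡.cong length (filter-reject (ℕ._≟ b) (ℕ.>⇒≢ b<a))) (multiplicity-other m ys b<a)

-- Recursions in the largest allowed part

gf-all-suc : ∀ k → gf U? (suc k) ≈ inv (suc k) ⊛ gf U? k
gf-all-suc k = ≈-trans (gf-suc U? k) (blocks-const (suc k) (gf U? k))

filter-odd-replicate : ∀ m {a} ys → Even a → filter odd? (replicate m a ++ ys) ≡ filter odd? ys
filter-odd-replicate zero    ys e = ≡.refl
filter-odd-replicate (suc m) ys e = ≡.trans (filter-reject odd? (λ o → o e)) (filter-odd-replicate m ys e)

gf-pod-even : ∀ K → gf oddPartsDistinct? (suc K ℕ.* 2)
               ≈ inv (suc K ℕ.* 2) ⊛ gf oddPartsDistinct? (suc (K ℕ.* 2))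
gf-pod-even K = ≈-trans (gf-suc oddPartsDistinct? k) (≈-trans
  (blocks-cong (suc k) λ m → gf-cong _ oddPartsDistinct? k λ ys _ →
    ≡.subst Unique (filter-odd-replicate m ys (even-double (suc K))) ,
    ≡.subst Unique (≡.sym (filter-odd-replicate m ys (even-double (suc K)))))
  (blocks-const (suc k) _))
  where
  k : ℕ
  k = suc (K ℕ.* 2)

-- Only two multiplicities of an odd part survive: a single copy puts no condition on the smaller
-- parts (`c₁`), and two copies violate distinctness (`c₂`).
gf-pod-odd : ∀ K → gf oddPartsDistinct? (suc (K ℕ.* 2))
              ≈ gf oddPartsDistinct? (K ℕ.* 2) ⊕ q ^ suc (K ℕ.* 2) ⊛ gf oddPartsDistinct? (K ℕ.* 2)
gf-pod-odd K = begin
  gf oddPartsDistinct? a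
    ≈⟨ gf-suc oddPartsDistinct? k ⟩
  blocks a c
    ≈⟨ blocks-unfold a c ⟩
  c 0 ⊕ q ^ a ⊛ blocks a (c ∘ suc)
    ≈⟨ ⊕-congˡ (⊛-congˡ (blocks-unfold a (c ∘ suc))) ⟩
  c 0 ⊕ q ^ a ⊛ (c 1 ⊕ q ^ a ⊛ blocks a (c ∘ suc ∘ suc))
    ≈⟨ ⊕-congˡ (⊛-congˡ (⊕-cong c₁ (⊛-congˡ (≈-trans (blocks-cong a c₂) (blocks-const a 𝟘))))) ⟩
  c 0 ⊕ q ^ a ⊛ (c 0 ⊕ q ^ a ⊛ (inv a ⊛ 𝟘))
    ≈⟨ ⊕-congˡ (⊛-congˡ (⊕-congˡ (≈-trans (⊛-congˡ (⊛-zeroʳ (inv a))) (⊛-zeroʳ (q ^ a))))) ⟩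
  c 0 ⊕ q ^ a ⊛ (c 0 ⊕ 𝟘)
    ≈⟨ ⊕-congˡ (⊛-congˡ (⊕-identityʳ (c 0))) ⟩
  c 0 ⊕ q ^ a ⊛ c 0 ∎
  where
  open SetoidReasoning setoid
  k a : ℕ
  k = K ℕ.* 2
  a = suc k
  a-odd : Odd a
  a-odd = odd-suc (even-double K)
  c : ℕ → Series
  c m = gf (oddPartsDistinct? ∘ (replicate m a ++_)) k
  c₁ : c 1 ≈ c 0
  c₁ = gf-cong _ _ k λ ys ys< →
    (λ uniq → case ≡.subst Unique (filter-accept odd? {xs = ys} a-odd) uniq of λ { (_ ∷ u) → u }) ,
    (λ uniq → ≡.subst Unique (≡.sym (filter-accept odd? {xs = ys} a-odd))
      (All.filter⁺ odd? (All.map ℕ.>⇒≢ ys<) ∷ uniq))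
  c₂ : ∀ m → c (suc (suc m)) ≈ 𝟘
  c₂ m = gf-none _ k λ ys _ uniq →
    case ≡.subst Unique (≡.trans (filter-accept odd? a-odd)
           (≡.cong (a ∷_) (filter-accept odd? {xs = replicate m a ++ ys} a-odd))) uniq
    of λ { ((a≢a ∷ _) ∷ _) → a≢a ≡.refl }

-- The condition on the parts below the largest even part in a partition counted by `EOBar`; its
-- generating function is the `E` of the algebraic argument.
AllEvenEvenly : List ℕ → Set
AllEvenEvenly xs = All (λ a → Even a × Even (multiplicity a xs)) xs

allEvenEvenly? : Decidable AllEvenEvenly
allEvenEvenly? xs = all? (λ a → even? a ×-dec even? (multiplicity a xs)) xs

allEvenEvenly⁻ : ∀ m {a ys} → All (ℕ._< a) ys → AllEvenEvenly (replicate m a ++ ys) →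
                 (m ≢ 0 → Even a) × Even m × AllEvenEvenly ys
allEvenEvenly⁻ zero {a} {ys} ys< E = contradiction ≡.refl , 2 ∣0 , E
allEvenEvenly⁻ m@(suc _) {a} {ys} ys< E@((e , e′) ∷ _) =
  const e , ≡.subst Even (multiplicity-self m a ys<) e′ ,
  All.zipWith (λ (b<a , e , e′) → e , ≡.subst Even (multiplicity-other m ys b<a) e′) (ys< , All.++⁻ʳ (replicate m a) E)

allEvenEvenly⁺ : ∀ m {a ys} → All (ℕ._< a) ys → Even a → Even m → AllEvenEvenly ys →
                 AllEvenEvenly (replicate m a ++ ys)
allEvenEvenly⁺ m {a} {ys} ys< a-even m-even E = All.++⁺
  (All.replicate⁺ m (a-even , ≡.subst Even (≡.sym (multiplicity-self m a ys<)) m-even))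
  (All.zipWith (λ (b<a , e , e′) → e , ≡.subst Even (≡.sym (multiplicity-other m ys b<a)) e′) (ys< , E))

gf-allEvenEvenly-odd : ∀ K → gf allEvenEvenly? (suc (K ℕ.* 2)) ≈ gf allEvenEvenly? (K ℕ.* 2)
gf-allEvenEvenly-odd K = begin
  gf allEvenEvenly? a                     ≈⟨ gf-suc allEvenEvenly? k ⟩
  blocks a c                              ≈⟨ blocks-unfold a c ⟩
  c 0 ⊕ q ^ a ⊛ blocks a (c ∘ suc)        ≈⟨ ⊕-congˡ (⊛-congˡ (≈-trans (blocks-cong a c₊) (blocks-const a 𝟘))) ⟩
  c 0 ⊕ q ^ a ⊛ (inv a ⊛ 𝟘)               ≈⟨ ⊕-congˡ (≈-trans (⊛-congˡ (⊛-zeroʳ (inv a))) (⊛-zeroʳ (q ^ a))) ⟩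
  c 0 ⊕ 𝟘                                 ≈⟨ ⊕-identityʳ (c 0) ⟩
  c 0                                     ∎
  where
  open SetoidReasoning setoid
  k a : ℕ
  k = K ℕ.* 2
  a = suc k
  c : ℕ → Series
  c m = gf (allEvenEvenly? ∘ (replicate m a ++_)) k
  c₊ : ∀ m → c (suc m) ≈ 𝟘
  c₊ m = gf-none _ k λ ys ys< E → odd-suc (even-double K) (proj₁ (allEvenEvenly⁻ (suc m) ys< E) λ ())

gf-allEvenEvenly-even : ∀ K → gf allEvenEvenly? (suc K ℕ.* 2)
                ≈ inv (suc K ℕ.* 2 ℕ.* 2) ⊛ gf allEvenEvenly? (suc (K ℕ.* 2))
gf-allEvenEvenly-even K = ≈-trans (gf-suc allEvenEvenly? k) (≈-trans
  (blocks-cong a (≈-alternate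
    (λ m m-even → gf-cong _ allEvenEvenly? k λ ys ys< →
      (λ E → proj₂ (proj₂ (allEvenEvenly⁻ m ys< E))) ,
      allEvenEvenly⁺ m ys< (even-double (suc K)) m-even)
    (λ m m-odd → gf-none _ k λ ys ys< E → m-odd (proj₁ (proj₂ (allEvenEvenly⁻ m ys< E))))))
  (blocks-alternate a _))
  where
  k a : ℕ
  k = suc (K ℕ.* 2)
  a = suc k

∈-replicate-++ : ∀ m {a x : ℕ} {ys : List ℕ} → x ∈ ys → x ∈ replicate m a ++ ys
∈-replicate-++ m {a} = ∈-++⁺ʳ (replicate m a)

-- An odd `a` cannot be a largest even part, so its multiplicity is even; for the same reason its
-- removal does not change which part is the largest even one.
eoBar-odd⁻ : ∀ m {a ys} → All (ℕ._< a) ys → Odd a → EOBarPartition (replicate m a ++ ys) →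
             Even m × EOBarPartition ys
eoBar-odd⁻ m {a} {ys} ys< a-odd (below , only) =
  m-even m only ,
  All.tabulate (λ b∈ → All.tabulate λ c∈ →
    All.lookup (All.lookup below (∈-replicate-++ m b∈)) (∈-replicate-++ m c∈)) ,
  All.tabulate λ {b} b∈ →
    let mult  = multiplicity-other m ys (All.lookup ys< b∈)
        (f , g) = All.lookup only (∈-replicate-++ m b∈)
    in (λ o → let (e , largest) = f (≡.subst Odd (≡.sym mult) o)
              in e , All.tabulate (λ c∈ → All.lookup largest (∈-replicate-++ m c∈))) ,
       (λ (e , largest) → ≡.subst Odd mult
         (g (e , All.++⁺ (All.replicate⁺ m (λ a-even → contradiction a-even a-odd)) largest)))
  where
  m-even : ∀ m → OnlyLargestEvenOddly (replicate m a ++ ys) → Even m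
  m-even zero      _             = 2 ∣0
  m-even m@(suc _) ((f , _) ∷ _) = decidable-stable (even? m) λ m-odd →
    a-odd (proj₁ (f (≡.subst Odd (≡.sym (multiplicity-self m a ys<)) m-odd)))

eoBar-odd⁺ : ∀ m {a ys} → All (ℕ._< a) ys → Odd a → Even m → EOBarPartition ys →
             EOBarPartition (replicate m a ++ ys)
eoBar-odd⁺ m {a} {ys} ys< a-odd m-even (below , only) =
  All.++⁺ (All.replicate⁺ m (All.universal (λ _ a-even → contradiction a-even a-odd) _))
    (All.zipWith (λ (b<a , r) → All.++⁺ (All.replicate⁺ m (λ _ _ → b<a)) r) (ys< , below)) ,
  All.++⁺
    (All.replicate⁺ m ((λ o → contradiction (≡.subst Even (≡.sym (multiplicity-self m a ys<)) m-even) o) ,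
                       (λ (a-even , _) → contradiction a-even a-odd)))
    (All.zipWith (λ {b} (b<a , f , g) → let mult = multiplicity-other m ys b<a in
        (λ o → let (e , largest) = f (≡.subst Odd mult o)
               in e , All.++⁺ (All.replicate⁺ m (λ a-even → contradiction a-even a-odd)) largest) ,
        (λ (e , largest) → ≡.subst Odd (≡.sym mult) (g (e , All.++⁻ʳ (replicate m a) largest))))
      (ys< , only))

-- As `a` exceeds all other parts, it is the largest even part and its multiplicity is odd. An odd
-- part would have to exceed `a`, so `ys` has none; a part of odd multiplicity in `ys` would be a
-- largest even part, although `a` is larger.
eoBar-even⁻ : ∀ m {a ys} → All (ℕ._< a) ys → Even a → EOBarPartition (replicate (suc m) a ++ ys) →
              Even m × AllEvenEvenly ys
eoBar-even⁻ m {a} {ys} ys< a-even (below ∷ _ , (_ , g) ∷ only) =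
  even-pred (≡.subst Odd (multiplicity-self (suc m) a ys<) (g (a-even , a-largest))) ,
  All.zipWith (λ {b} (b<a , r , f , _) →
      decidable-stable (even? b) (λ b-odd → ℕ.<-asym b<a (r a-even b-odd)) ,
      decidable-stable (even? _) (λ o → ℕ.<⇒≱ b<a
        (All.head (proj₂ (f (≡.subst Odd (≡.sym (multiplicity-other (suc m) ys b<a)) o))) a-even)))
    (ys< , All.zip (All.++⁻ʳ (replicate (suc m) a) below , All.++⁻ʳ (replicate m a) only))
  where
  a-largest : All (λ b → Even b → b ℕ.≤ a) (replicate (suc m) a ++ ys)
  a-largest = All.++⁺ (All.replicate⁺ (suc m) (const ℕ.≤-refl)) (All.map (λ b<a _ → ℕ.<⇒≤ b<a) ys<)

eoBar-even⁺ : ∀ m {a ys} → All (ℕ._< a) ys → Even a → Even m → AllEvenEvenly ys →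
              EOBarPartition (replicate (suc m) a ++ ys)
eoBar-even⁺ m {a} {ys} ys< a-even m-even E =
  All.universal (λ _ → All.map (λ b-even _ b-odd → contradiction b-even b-odd)
    (All.++⁺ (All.replicate⁺ (suc m) a-even) (All.map proj₁ E))) _ ,
  All.++⁺
    (All.replicate⁺ (suc m)
      ((λ _ → a-even , All.++⁺ (All.replicate⁺ (suc m) (const ℕ.≤-refl)) (All.map (λ b<a _ → ℕ.<⇒≤ b<a) ys<)) ,
       (λ _ → ≡.subst Odd (≡.sym (multiplicity-self (suc m) a ys<)) (odd-suc m-even))))
    (All.zipWith (λ (b<a , _ , e) →
        (λ o → contradiction (≡.subst Even (≡.sym (multiplicity-other (suc m) ys b<a)) e) o) ,
        (λ (_ , largest) → contradiction (All.head largest a-even) (ℕ.<⇒≱ b<a)))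
      (ys< , E))

gf-eoBar-odd : ∀ K → gf eoBarPartition? (suc (K ℕ.* 2))
                ≈ inv (suc (K ℕ.* 2) ℕ.* 2) ⊛ gf eoBarPartition? (K ℕ.* 2)
gf-eoBar-odd K = ≈-trans (gf-suc eoBarPartition? k) (≈-trans
  (blocks-cong a (≈-alternate
    (λ m m-even → gf-cong _ eoBarPartition? k λ ys ys< →
      (λ eo → proj₂ (eoBar-odd⁻ m ys< a-odd eo)) , eoBar-odd⁺ m ys< a-odd m-even)
    (λ m m-odd → gf-none _ k λ ys ys< eo → m-odd (proj₁ (eoBar-odd⁻ m ys< a-odd eo)))))
  (blocks-alternate a _))
  where
  k a : ℕ
  k = K ℕ.* 2
  a = suc k
  a-odd : Odd a
  a-odd = odd-suc (even-double K)

-- Multiplicity 0 gives the first summand. A positive multiplicity must be odd: one copy gives the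
-- power of q, and the further copies come in pairs.
gf-eoBar-even : ∀ K → gf eoBarPartition? (suc K ℕ.* 2)
                 ≈ gf eoBarPartition? (suc (K ℕ.* 2))
                   ⊕ q ^ (suc K ℕ.* 2) ⊛ (inv (suc K ℕ.* 2 ℕ.* 2) ⊛ gf allEvenEvenly? (suc (K ℕ.* 2)))
gf-eoBar-even K = ≈-trans (gf-suc eoBarPartition? k) (≈-trans (blocks-unfold a _)
  (⊕-congˡ (⊛-congˡ (≈-trans
    (blocks-cong a (≈-alternate
      (λ m m-even → gf-cong _ allEvenEvenly? k λ ys ys< →
        (λ eo → proj₂ (eoBar-even⁻ m ys< a-even eo)) , eoBar-even⁺ m ys< a-even m-even)
      (λ m m-odd → gf-none _ k λ ys ys< eo → m-odd (proj₁ (eoBar-even⁻ m ys< a-even eo)))))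
    (blocks-alternate a _)))))
  where
  k a : ℕ
  k = suc (K ℕ.* 2)
  a = suc k
  a-even : Even a
  a-even = even-double (suc K)

-- Comparison of coefficients

gf-pod-eoBar : ∀ K → gf oddPartsDistinct? (K ℕ.* 2) ⊛ gf eoBarPartition? (K ℕ.* 2)
                   ≈ gf U? (K ℕ.* 2) ⊛ partialSum 0 (suc K)
gf-pod-eoBar = Pod-EO (gf U?) (gf oddPartsDistinct?) (gf allEvenEvenly?) (gf eoBarPartition?)
  (gf-zero U? tt) gf-all-suc
  (gf-zero oddPartsDistinct? []) gf-pod-odd gf-pod-even
  (gf-zero allEvenEvenly? []) gf-allEvenEvenly-odd gf-allEvenEvenly-even
  (gf-zero eoBarPartition? ([] , [])) gf-eoBar-odd gf-eoBar-even

-- From the truncated Rogers-Fine sums to ψ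

z⊛-≈[]𝟘 : ∀ m K {f} → f ≈[ K ℕ.* 2 ] 𝟘 → z m ⊛ f ≈[ suc K ℕ.* 2 ] 𝟘
z⊛-≈[]𝟘 m K f≈ n n< = ≡.trans
  (q^⊛-cong[] (suc (m ℕ.* 2) ℕ.* 2) f≈ n
    (ℕ.<-≤-trans n< (s≤s (s≤s (ℕ.m≤n+m (K ℕ.* 2) (m ℕ.* 2 ℕ.* 2))))))
  (_≈_.coeff (⊛-zeroʳ (z m)) n)

-- Each of the K factors `z m` of `B m K` has order at least 2 in q.
B-≈[]𝟘 : ∀ m K → B m K ≈[ K ℕ.* 2 ] 𝟘
B-≈[]𝟘 m zero    n ()
B-≈[]𝟘 m (suc K) n n< = ≡.trans
  (_≈_.coeff (≈-trans (⊛-congˡ (⊛-assoc (z m) (Z (suc K ℕ.+ m)) (v (K ℕ.+ m)))) (x∙yz≈y∙xz (B m K) (z m) tail)) n)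
  (z⊛-≈[]𝟘 m K
    (λ k k< → ≡.trans (⊛-cong[] (B-≈[]𝟘 m K) (≈⇒≈[] ≈-refl) k k<) (_≈_.coeff (⊛-zeroˡ tail) k)) n n<)
  where
  tail : Series
  tail = Z (suc K ℕ.+ m) ⊛ v (K ℕ.+ m)

-- Twice a triangular number, free of the division in `T`. Thus `q ^ pronic j` is x^(T j), and
-- `theta s M` is the part of ψ with s ≤ j < s + M.
pronic : ℕ → ℕ
pronic j = j ℕ.* suc j

theta : ℕ → ℕ → Series
theta s zero    = 𝟘
theta s (suc M) = q ^ pronic s ⊕ theta (suc s) M

-- Each use of `rogersFine` lowers K and raises m by one, emitting the terms of ψ with indices 2m
-- and 2m + 1. The prefactor supplies the exponents that `z m` and `w m` need to step from one
-- pronic number to the next.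
partialSum-theta : ∀ m K → q ^ pronic (m ℕ.* 2) ⊛ partialSum m K
                           ≈[ pronic (m ℕ.* 2) ℕ.+ K ℕ.* 2 ] theta (m ℕ.* 2) (K ℕ.* 2)
partialSum-theta m zero    n _  = _≈_.coeff (⊛-zeroʳ (q ^ pronic (m ℕ.* 2))) n
partialSum-theta m (suc K) n n< = begin
  (q ^ a ⊛ partialSum m (suc K)) n
    ≡⟨ q^⊛-cong[] a rogersFine[] n n< ⟩
  (q ^ a ⊛ (𝟙 ⊕ z m ⊕ z m ⊛ w m ⊛ partialSum (suc m) K)) n
    ≡⟨ _≈_.coeff expand n ⟩
  (q ^ a ⊕ (q ^ pronic (suc (m ℕ.* 2)) ⊕ q ^ pronic (suc m ℕ.* 2) ⊛ partialSum (suc m) K)) n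
    ≡⟨ ⊕-cong[] (≈⇒≈[] ≈-refl) (⊕-cong[] (≈⇒≈[] ≈-refl) (partialSum-theta (suc m) K)) n
         (ℕ.<-≤-trans n< (ℕ.≤-trans (ℕ.m≤m+n _ (m ℕ.* 8 ℕ.+ 4)) (ℕ.≤-reflexive (modulus m K)))) ⟩
  theta (m ℕ.* 2) (suc K ℕ.* 2) n ∎
  where
  open ≡-Reasoning
  a : ℕ
  a = pronic (m ℕ.* 2)
  -- The offset `pronic (m * 2)` grows by 8m + 6 when m increases, while `K * 2` drops by 2; the
  -- induction hypothesis thus reaches 8m + 4 further than required.
  modulus : ∀ m K → m ℕ.* 2 ℕ.* suc (m ℕ.* 2) ℕ.+ suc K ℕ.* 2 ℕ.+ (m ℕ.* 8 ℕ.+ 4)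
                  ≡ suc m ℕ.* 2 ℕ.* suc (suc m ℕ.* 2) ℕ.+ K ℕ.* 2
  modulus = ℕ-solve-∀
  rogersFine[] : partialSum m (suc K) ≈[ suc K ℕ.* 2 ] 𝟙 ⊕ z m ⊕ z m ⊛ w m ⊛ partialSum (suc m) K
  rogersFine[] k k< = begin
    partialSum m (suc K) k
      ≡⟨ _≈_.coeff (⊕-identityʳ (partialSum m (suc K))) k ⟨
    (partialSum m (suc K) ⊕ 𝟘) k
      ≡⟨ ⊕-cong[] {f = partialSum m (suc K)} (≈⇒≈[] ≈-refl) (z⊛-≈[]𝟘 m K (B-≈[]𝟘 m K)) k k< ⟨
    (partialSum m (suc K) ⊕ z m ⊛ B m K) k
      ≡⟨ _≈_.coeff (rogersFine m K) k ⟩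
    (𝟙 ⊕ z m ⊕ z m ⊛ w m ⊛ partialSum (suc m) K) k ∎
  odd-exponent : ∀ m → m ℕ.* 2 ℕ.* suc (m ℕ.* 2) ℕ.+ suc (m ℕ.* 2) ℕ.* 2
                     ≡ suc (m ℕ.* 2) ℕ.* suc (suc (m ℕ.* 2))
  odd-exponent = ℕ-solve-∀
  even-exponent : ∀ m → suc (m ℕ.* 2) ℕ.* suc (suc (m ℕ.* 2)) ℕ.+ suc m ℕ.* 2 ℕ.* 2
                      ≡ suc m ℕ.* 2 ℕ.* suc (suc m ℕ.* 2)
  even-exponent = ℕ-solve-∀
  q^+ : ∀ {b c d} → b ℕ.+ c ≡ d → q ^ b ⊛ q ^ c ≈ q ^ d
  q^+ {b} {c} ≡.refl = ≈-sym (^-homo-* q b c)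
  expand : q ^ a ⊛ (𝟙 ⊕ z m ⊕ z m ⊛ w m ⊛ partialSum (suc m) K)
         ≈ q ^ a ⊕ (q ^ pronic (suc (m ℕ.* 2)) ⊕ q ^ pronic (suc m ℕ.* 2) ⊛ partialSum (suc m) K)
  expand = ≈-trans (⊛-distribˡ (q ^ a) (𝟙 ⊕ z m) (z m ⊛ w m ⊛ partialSum (suc m) K)) (≈-trans
    (⊕-cong
      (≈-trans (⊛-distribˡ (q ^ a) 𝟙 (z m)) (⊕-cong (⊛-identityʳ (q ^ a)) az))
      (≈-trans (≈-sym (⊛-assoc (q ^ a) (z m ⊛ w m) (partialSum (suc m) K)))
        (⊛-congʳ (≈-trans (≈-sym (⊛-assoc (q ^ a) (z m) (w m))) (≈-trans (⊛-congʳ az)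
          (q^+ {pronic (suc (m ℕ.* 2))} {suc m ℕ.* 2 ℕ.* 2} (even-exponent m)))))))
    (⊕-assoc _ _ _))
    where
    az : q ^ a ⊛ z m ≈ q ^ pronic (suc (m ℕ.* 2))
    az = q^+ {a} {suc (m ℕ.* 2) ℕ.* 2} (odd-exponent m)

theta-≈[]𝟘 : ∀ s M → theta s M ≈[ s ] 𝟘
theta-≈[]𝟘 s zero    n n< = ≡.refl
theta-≈[]𝟘 s (suc M) n n<s = begin
  (q ^ pronic s ⊕ theta (suc s) M) n
    ≡⟨ ⊕-coeff (q ^ pronic s) (theta (suc s) M) n ⟩
  (q ^ pronic s) n ℤ.+ theta (suc s) M n
    ≡⟨ ≡.cong₂ ℤ._+_ q^≡0 (theta-≈[]𝟘 (suc s) M n (ℕ.m≤n⇒m≤1+n n<s)) ⟩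
  + 0 ∎
  where
  open ≡-Reasoning
  q^≡0 : (q ^ pronic s) n ≡ + 0
  q^≡0 = ≡.trans (≡.sym (_≈_.coeff (⊛-identityʳ (q ^ pronic s)) n))
    (q^⊛-< (pronic s) 𝟙 n (ℕ.<-≤-trans n<s (ℕ.m≤m*n s (suc s))))

-- The extra terms have indices j ≥ s + M, and their exponents satisfy `pronic j` ≥ j.
theta-stable : ∀ s M d → theta s (M ℕ.+ d) ≈[ s ℕ.+ M ] theta s M
theta-stable s zero    d n n< = theta-≈[]𝟘 s d n (≡.subst (n ℕ.<_) (ℕ.+-identityʳ s) n<)
theta-stable s (suc M) d n n< =
  ⊕-cong[] (≈⇒≈[] ≈-refl) (theta-stable (suc s) M d) n (≡.subst (n ℕ.<_) (ℕ.+-suc s M) n<)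

-- The generating function with no bound on the parts: a partition of n has no part above n, so the
-- diagonal collects the stable coefficients.
total : Decidable P → Series
total P? n = gf P? n n

total-count : ∀ (P? : Decidable P) n → total P? n ≡ + count P? n
total-count P? n = gf-coeff P? n n

total-≈[] : ∀ (P? : Decidable P) {n k} → n ℕ.≤ k → total P? ≈[ suc n ] gf P? k
total-≈[] P? n≤k j (s≤s j≤n) = ≡.sym (gf-stable P? (ℕ.≤-trans j≤n n≤k))

total-pod-eoBar : ∀ n → (total oddPartsDistinct? ⊛ total eoBarPartition?) n ≡ (theta 0 (suc n) ⊛ total U?) n
total-pod-eoBar n = begin
  (total oddPartsDistinct? ⊛ total eoBarPartition?) n
    -- The truncated identity is taken at K = n, where the bound 2n on the parts is large enough for
    -- all coefficients up to n.
    ≡⟨ ⊛-cong[] (total-≈[] oddPartsDistinct? n≤2n) (total-≈[] eoBarPartition? n≤2n) n ℕ.≤-refl ⟩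
  (gf oddPartsDistinct? (n ℕ.* 2) ⊛ gf eoBarPartition? (n ℕ.* 2)) n
    ≡⟨ _≈_.coeff (≈-trans (gf-pod-eoBar n) (⊛-comm (gf U? (n ℕ.* 2)) (partialSum 0 (suc n)))) n ⟩
  (partialSum 0 (suc n) ⊛ gf U? (n ℕ.* 2)) n
    ≡⟨ ⊛-cong[] partialSum≈theta (λ j j< → ≡.sym (total-≈[] U? n≤2n j j<)) n ℕ.≤-refl ⟩
  (theta 0 (suc n) ⊛ total U?) n ∎
  where
  open ≡-Reasoning
  n≤2n : n ℕ.≤ n ℕ.* 2
  n≤2n = ℕ.m≤m*n n 2
  partialSum≈theta : partialSum 0 (suc n) ≈[ suc n ] theta 0 (suc n)
  partialSum≈theta j j< = begin
    partialSum 0 (suc n) j             ≡⟨ _≈_.coeff (⊛-identityˡ (partialSum 0 (suc n))) j ⟨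
    (𝟙 ⊛ partialSum 0 (suc n)) j       ≡⟨ partialSum-theta 0 (suc n) j (ℕ.<-≤-trans j< (ℕ.m≤m*n (suc n) 2)) ⟩
    theta 0 (suc n ℕ.* 2) j
      ≡⟨ ≡.cong (λ M → theta 0 M j)
           (≡.trans (ℕ.*-comm (suc n) 2) (≡.cong (suc n ℕ.+_) (ℕ.+-identityʳ (suc n)))) ⟩
    theta 0 (suc n ℕ.+ suc n) j        ≡⟨ theta-stable 0 (suc n) (suc n) j j< ⟩
    theta 0 (suc n) j                  ∎

-- The two series of the theorem as coefficients of products

2*T≡pronic : ∀ j → 2 ℕ.* T j ≡ pronic j
2*T≡pronic j = ≡.trans (ℕ.m*[n/m]≡n 2∣) (≡.cong (j ℕ.*_) (ℕ.+-comm j 1))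
  where
  2∣ : Even (j ℕ.* (j ℕ.+ 1))
  2∣ with even? j
  ... | yes e = ∣m⇒∣m*n (j ℕ.+ 1) e
  ... | no  o = ∣n⇒∣m*n j (≡.subst Even (ℕ.+-comm 1 j) (even-suc o))
    where
    even-suc : ∀ {n} → Odd n → Even (suc n)
    even-suc o = even-pred (o ∘ even-pred²)

-- For e > n both sides vanish: `p` by its convention at negative arguments, the product because its
-- order is at least e.
p-shift : ∀ n e → + p (+ n - + e) ≡ (q ^ e ⊛ total U?) n
p-shift n e with e ℕ.≤? n
... | yes e≤n = begin
  + p (+ n - + e)          ≡⟨ ≡.cong (+_ ∘ p) (≡.trans (ℤ.m-n≡m⊖n n e) (ℤ.⊖-≥ e≤n)) ⟩
  + length (partitions k)  ≡⟨ ≡.cong (+_ ∘ length) (filter-all U? (All.universal (λ _ → tt) (partitions k))) ⟨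
  + count U? k             ≡⟨ total-count U? k ⟨
  total U? k               ≡⟨ q^⊛-≥ e (total U?) n e≤n ⟨
  (q ^ e ⊛ total U?) n     ∎
  where
  open ≡-Reasoning
  k : ℕ
  k = n ℕ.∸ e
... | no e≰n = ≡.trans
  (≡.cong (+_ ∘ p) (≡.trans (ℤ.m-n≡m⊖n n e) (ℤ.⊖-< (ℕ.≰⇒> e≰n))))
  (≡.trans p-negative (≡.sym (q^⊛-< e (total U?) n (ℕ.≰⇒> e≰n))))
  where
  p-negative : + p (ℤ.- (+ (e ℕ.∸ n))) ≡ + 0
  p-negative with e ℕ.∸ n in eq
  ... | zero  = contradiction (ℕ.m∸n≡0⇒m≤n eq) e≰n
  ... | suc _ = ≡.refl

sum-theta : ∀ n s M (f : ℕ → ℕ) → (∀ j → + f j ≡ (q ^ pronic (s ℕ.+ j) ⊛ total U?) n) →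
            + sum (applyUpTo f M) ≡ (theta s M ⊛ total U?) n
sum-theta n s zero    f f≡ = ≡.sym (_≈_.coeff (⊛-zeroˡ (total U?)) n)
sum-theta n s (suc M) f f≡ = begin
  + (f 0 ℕ.+ sum (applyUpTo (f ∘ suc) M))
    ≡⟨ ℤ.pos-+ (f 0) _ ⟩
  + f 0 ℤ.+ + sum (applyUpTo (f ∘ suc) M)
    ≡⟨ ≡.cong₂ ℤ._+_
         (≡.trans (f≡ 0) (≡.cong (λ i → (q ^ pronic i ⊛ total U?) n) (ℕ.+-identityʳ s)))
         (sum-theta n (suc s) M (f ∘ suc) λ j →
           ≡.trans (f≡ (suc j)) (≡.cong (λ i → (q ^ pronic i ⊛ total U?) n) (ℕ.+-suc s j))) ⟩
  (q ^ pronic s ⊛ total U?) n ℤ.+ (theta (suc s) M ⊛ total U?) n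
    ≡⟨ ⊕-coeff (q ^ pronic s ⊛ total U?) (theta (suc s) M ⊛ total U?) n ⟨
  (q ^ pronic s ⊛ total U? ⊕ theta (suc s) M ⊛ total U?) n
    ≡⟨ _≈_.coeff (⊛-distribʳ (total U?) (q ^ pronic s) (theta (suc s) M)) n ⟨
  (theta s (suc M) ⊛ total U?) n ∎
  where open ≡-Reasoning

sum-p : ∀ n M → + sum (map (λ j → p (+ n - + (2 ℕ.* T j))) (upTo M)) ≡ (theta 0 M ⊛ total U?) n
sum-p n M = ≡.trans (≡.cong (+_ ∘ sum) (map-upTo _ M)) (sum-theta n 0 M _ λ j →
  ≡.trans (p-shift n (2 ℕ.* T j)) (≡.cong (λ e → (q ^ e ⊛ total U?) n) (2*T≡pronic j)))

-- Passing from n to `suc n` shifts `f` and leaves `g` alone, just as in the definition of ⊛, since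
-- n + 1 - (j + 1) = n - j. The terms with n < j < M have a negative argument in `g` and vanish.
sum-⊛ : ∀ n M (f : ℕ → ℕ) (g : ℤ → ℕ) → (∀ k → g -[1+ k ] ≡ 0) → n ℕ.< M →
        + sum (applyUpTo (λ j → f j ℕ.* g (+ n - + j)) M) ≡ ((+_ ∘ f) ⊛ (+_ ∘ g ∘ +_)) n
sum-⊛ zero (suc M) f g g-neg _ = begin
  + (f 0 ℕ.* g (+ 0) ℕ.+ sum (applyUpTo (λ j → f (suc j) ℕ.* g -[1+ j ]) M))
    ≡⟨ ≡.cong (λ i → + (f 0 ℕ.* g (+ 0) ℕ.+ i)) (vanish (f ∘ suc) (g ∘ -[1+_]) g-neg M) ⟩
  + (f 0 ℕ.* g (+ 0) ℕ.+ 0)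
    ≡⟨ ≡.cong +_ (ℕ.+-identityʳ _) ⟩
  + (f 0 ℕ.* g (+ 0))
    ≡⟨ ≡.trans (ℤ.pos-* (f 0) (g (+ 0))) (≡.sym (⊛-zero-coeff (+_ ∘ f) (+_ ∘ g ∘ +_))) ⟩
  ((+_ ∘ f) ⊛ (+_ ∘ g ∘ +_)) 0 ∎
  where
  open ≡-Reasoning
  vanish : ∀ (f g : ℕ → ℕ) → (∀ k → g k ≡ 0) → ∀ M → sum (applyUpTo (λ j → f j ℕ.* g j) M) ≡ 0
  vanish f g g≡0 zero    = ≡.refl
  vanish f g g≡0 (suc M) = ≡.cong₂ ℕ._+_
    (≡.trans (≡.cong (f 0 ℕ.*_) (g≡0 0)) (ℕ.*-zeroʳ (f 0))) (vanish (f ∘ suc) (g ∘ suc) (g≡0 ∘ suc) M)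
sum-⊛ (suc n) (suc M) f g g-neg (s≤s n<M) = begin
  + (f 0 ℕ.* g (+ suc n - + 0) ℕ.+ sum (applyUpTo (λ j → f (suc j) ℕ.* g (+ suc n - + suc j)) M))
    ≡⟨ ℤ.pos-+ (f 0 ℕ.* g (+ suc n - + 0)) _ ⟩
  + (f 0 ℕ.* g (+ suc n - + 0)) ℤ.+ + sum (applyUpTo (λ j → f (suc j) ℕ.* g (+ suc n - + suc j)) M)
    ≡⟨ ≡.cong₂ ℤ._+_
         (≡.trans (≡.cong (λ i → + (f 0 ℕ.* g i)) (ℤ.+-identityʳ (+ suc n))) (ℤ.pos-* (f 0) (g (+ suc n))))
         (≡.trans (≡.cong (+_ ∘ sum) (applyUpTo-cong (λ j → ≡.cong (λ i → f (suc j) ℕ.* g i) (cancel j)) M))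
                  (sum-⊛ n M (f ∘ suc) g g-neg n<M)) ⟩
  + f 0 ℤ.* + g (+ suc n) ℤ.+ ((+_ ∘ f ∘ suc) ⊛ (+_ ∘ g ∘ +_)) n
    ≡⟨ ⊛-suc-coeff (+_ ∘ f) (+_ ∘ g ∘ +_) n ⟨
  ((+_ ∘ f) ⊛ (+_ ∘ g ∘ +_)) (suc n) ∎
  where
  open ≡-Reasoning
  cancel : ∀ j → + suc n - + suc j ≡ + n - + j
  cancel j = ≡.trans (ℤ.[1+m]⊖[1+n]≡m⊖n n j) (≡.sym (ℤ.m-n≡m⊖n n j))
  applyUpTo-cong : ∀ {f g : ℕ → ℕ} → (∀ j → f j ≡ g j) → ∀ M → applyUpTo f M ≡ applyUpTo g M
  applyUpTo-cong f≡g zero    = ≡.refl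
  applyUpTo-cong f≡g (suc M) = ≡.cong₂ _∷_ (f≡g 0) (applyUpTo-cong (f≡g ∘ suc) M)

sum-pod-eoBar : ∀ n M → n ℕ.< M → + sum (map (λ j → pod j ℕ.* EOBar (+ n - + j)) (upTo M))
                                ≡ (total oddPartsDistinct? ⊛ total eoBarPartition?) n
sum-pod-eoBar n M n<M = begin
  + sum (map (λ j → pod j ℕ.* EOBar (+ n - + j)) (upTo M))
    ≡⟨ ≡.cong (+_ ∘ sum) (map-upTo _ M) ⟩
  + sum (applyUpTo (λ j → pod j ℕ.* EOBar (+ n - + j)) M)
    ≡⟨ sum-⊛ n M pod EOBar (λ _ → ≡.refl) n<M ⟩
  ((+_ ∘ pod) ⊛ (+_ ∘ EOBar ∘ +_)) n
    ≡⟨ _≈_.coeff (⊛-cong (pointwise (total-count oddPartsDistinct?)) (pointwise (total-count eoBarPartition?))) n ⟨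
  (total oddPartsDistinct? ⊛ total eoBarPartition?) n ∎
  where open ≡-Reasoning

open import Data.Nat using (_*_)

theorem4p19 : (n : ℕ) →
    ∃ λ s → HasSum (λ j → p (+ n - + (2 * T j))) s
    × HasSum (λ j → pod j * EOBar (+ n - + j)) s
-- The threshold `suc n` serves both series: for j > n the arguments n - j and n - 2 T j are
-- negative, the latter because 2 T j ≥ j.
theorem4p19 n = s , (suc n , p-sum) , (suc n , λ M n<M → ℤ.+-injective
    (≡.trans (sum-pod-eoBar n M n<M) (≡.sym (sum-pod-eoBar n (suc n) ℕ.≤-refl))))
  where
  s : ℕ
  s = sum (map (λ j → pod j * EOBar (+ n - + j)) (upTo (suc n)))
  p-sum : ∀ M → n ℕ.< M → sum (map (λ j → p (+ n - + (2 * T j))) (upTo M)) ≡ s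
  p-sum M n<M = ℤ.+-injective (begin
    + sum (map (λ j → p (+ n - + (2 * T j))) (upTo M))
      ≡⟨ sum-p n M ⟩
    (theta 0 M ⊛ total U?) n
      ≡⟨ ≡.cong (λ M → (theta 0 M ⊛ total U?) n) (ℕ.m+[n∸m]≡n n<M) ⟨
    (theta 0 (suc n ℕ.+ (M ℕ.∸ suc n)) ⊛ total U?) n
      ≡⟨ ⊛-cong[] (theta-stable 0 (suc n) (M ℕ.∸ suc n)) (≈⇒≈[] ≈-refl) n ℕ.≤-refl ⟩
    (theta 0 (suc n) ⊛ total U?) n
      ≡⟨ total-pod-eoBar n ⟨
    (total oddPartsDistinct? ⊛ total eoBarPartition?) n
      ≡⟨ sum-pod-eoBar n (suc n) ℕ.≤-refl ⟨
    + s ∎)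
    where open ≡-Reasoning
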